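{- Let $\eta \in (0,1)$ be a constant. For any integers $k,d,s$ satisfying $s = k^{1-\eta}$ and $k \ge \log d + o(k) + O_\eta(1)$, Valiant's algorithm exactly learns any $(k,d,s)$-CNF formula $\Phi$ on $n$ variables from i.i.d. uniform random solutions of $\Phi$ with probability at least $1-\delta$, using sample complexity $T = O_{k,\eta}(\log \frac{n}{\delta})$ and computational complexity $O_{k,\eta}(n^k \log \frac{n}{\delta})$.
   Context: $\log$ denotes $\log_2$. A CNF formula $\Phi=(V,\mathcal{C})$ on a set $V$ of $n$ Boolean variables is a conjunction of clauses, each clause a disjunction of literals; $\mathrm{vbl}(c)$ is the set of variables of clause $c$. For $c$ on $k$ distinct variables, its forbidden assignment is the unique assignment of $\mathrm{vbl}(c)$ violating $c$. $\mu_\Phi$ is the uniform distribution over satisfying assignments of $\Phi$. A $(k,d,s)$-CNF formula is one in which every clause contains exactly $k$ distinct variables, every variable appears in at most $d$ clauses, and any two distinct clauses share at most $s$ variables. Valiant's algorithm: given $n$, $k$ and samples $X_1,\dots,X_T$, start with the CNF $\widehat\Phi$ containing all $2^k\binom{n}{k}$ possible clauses on $k$ distinct variables of $V$; remove every clause $c$ for which some sample $X_i$ restricted to $\mathrm{vbl}(c)$ violates $c$; output the remaining formula. "Exactly learns $\Phi$ with probability at least $1-\delta$" means: given $T$ i.i.d. samples from $\mu_\Phi$, with probability at least $1-\delta$ the output $\widehat\Phi$ satisfies $\mu_{\widehat\Phi}=\mu_\Phi$ (same set of satisfying assignments). -}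

module Defs where

open import Data.Bool using (Bool; true; false; if_then_else_)
import Data.Bool.Properties as Bool
open import Data.Fin using (Fin)
import Data.Fin as Fin
import Data.Fin.Properties as Fin
open import Data.Integer using (+_)
open import Data.List using (List; []; _∷_; map; filter; length; foldr; cartesianProductWith; allFin)
open import Data.List.Membership.Propositional using (_∈_)
open import Data.List.Relation.Unary.All using (All; all?)
open import Data.List.Relation.Unary.AllPairs using (AllPairs)
open import Data.List.Relation.Unary.Any using (Any; any?)
open import Data.List.Relation.Unary.Unique.Propositional using (Unique)
open import Data.Nat using (ℕ; zero; suc; _+_; _*_; _^_; _≤_; NonZero)
open import Data.Product using (∃; _×_; _,_; proj₁)
open import Data.Rational using (ℚ; 0ℚ; 1ℚ; _/_)
import Data.Rational as ℚ
import Data.Rational.Properties as ℚ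
open import Data.Sum using (_⊎_)
open import Data.Unit using (⊤; tt)
open import Data.Vec using (Vec; []; _∷_; lookup)
import Data.Vec as Vec
open import Relation.Binary.PropositionalEquality using (_≡_; _≢_)
open import Relation.Nullary using (¬_; does)
open import Relation.Unary using (Pred; Decidable)
import Data.List.Membership.DecPropositional as DecMembership
open import Level using (0ℓ)

------------------------------------------------------------------------
-- Real numbers (Dedekind cuts): lower q means q < x, upper q means x < q.

record ℝ : Set₁ where
  field
    lower upper : ℚ → Set
    lower-inhabited : ∃ lower
    upper-inhabited : ∃ upper
    lower-closed    : ∀ {p q} → p ℚ.< q → lower q → lower p
    upper-closed    : ∀ {p q} → p ℚ.< q → upper p → upper q
    lower-open      : ∀ {p} → lower p → ∃ λ q → p ℚ.< q × lower q
    upper-open      : ∀ {q} → upper q → ∃ λ p → p ℚ.< q × upper p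
    disjoint        : ∀ q → ¬ (lower q × upper q)
    located         : ∀ {p q} → p ℚ.< q → lower p ⊎ upper q

open ℝ public

-- x ∈ (0,1)
InUnitInterval : ℝ → Set
InUnitInterval x = lower x 0ℚ × upper x 1ℚ

-- s = k^(1-η) for a real η < 1: s lies above k^(p/q) for every positive
-- rational p/q < 1-η and below k^(p/q) for every rational p/q > 1-η; both
-- comparisons are raised to the power q.
_≡_^[1-_] : ℕ → ℕ → ℝ → Set
s ≡ k ^[1- η ] =
    (∀ p q → .{{_ : NonZero p}} → .{{_ : NonZero q}} →
       upper η (1ℚ ℚ.- + p / q) → k ^ p ≤ s ^ q)
  × (∀ p q → .{{_ : NonZero p}} → .{{_ : NonZero q}} →
       lower η (1ℚ ℚ.- + p / q) → s ^ q ≤ k ^ p)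

-- m ≤ C · log₂ (n/δ) for a real δ > 0, i.e. δ^C · 2^m ≤ n^C; by continuity
-- this is r^C · 2^m ≤ n^C for all rationals r = a/b with 0 ≤ r < δ.
_≤_·log[_/_] : ℕ → ℕ → ℕ → ℝ → Set
m ≤ C ·log[ n / δ ] =
  ∀ a b → .{{_ : NonZero b}} → lower δ (+ a / b) → a ^ C * 2 ^ m ≤ (b * n) ^ C

-- k ≥ log₂ d + t for d ≥ 1, exponentiated.
_≥log_+_ : ℕ → ℕ → ℕ → Set
k ≥log d + t = d * 2 ^ t ≤ 2 ^ k

-- P ≥ 1-δ
_≥1-_ : ℚ → ℝ → Set
P ≥1- δ = ∀ {r} → upper δ r → 1ℚ ℚ.- r ℚ.≤ P

-- f(k) = o(k)
IsLittleO : (ℕ → ℕ) → Set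
IsLittleO f = ∀ m → ∃ λ K → ∀ k → K ≤ k → m * f k ≤ k

------------------------------------------------------------------------
-- CNF formulas

-- (v , true) is the literal v and (v , false) its negation.
Literal : ℕ → Set
Literal n = Fin n × Bool

Clause : ℕ → Set
Clause n = List (Literal n)

CNF : ℕ → Set
CNF n = List (Clause n)

Assignment : ℕ → Set
Assignment n = Vec Bool n

vbl : ∀ {n} → Clause n → List (Fin n)
vbl = map proj₁

Holds : ∀ {n} → Assignment n → Literal n → Set
Holds x (v , b) = lookup x v ≡ b

Satisfies : ∀ {n} → CNF n → Assignment n → Set
Satisfies Φ x = All (Any (Holds x)) Φ

holds? : ∀ {n} (x : Assignment n) → Decidable (Holds x)
holds? x (v , b) = lookup x v Bool.≟ b

satisfies? : ∀ {n} (Φ : CNF n) → Decidable (Satisfies Φ)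
satisfies? Φ x = all? (any? (holds? x)) Φ

module _ {n : ℕ} where
  open DecMembership (Fin._≟_ {n}) using (_∈?_)

  shared : Clause n → Clause n → ℕ
  shared c c′ = length (filter (_∈? vbl c′) (vbl c))

  degree : CNF n → Fin n → ℕ
  degree Φ v = length (filter (λ c → v ∈? vbl c) Φ)

-- Literals are listed by increasing variable, so that a clause (a set of
-- literals) on k distinct variables is represented by exactly one list and
-- distinct lists are distinct clauses.
IsKClause : ∀ {n} → ℕ → Clause n → Set
IsKClause k c = length c ≡ k × AllPairs Fin._<_ (vbl c)

record IsKDS-CNF {n : ℕ} (k d s : ℕ) (Φ : CNF n) : Set where
  field
    unique        : Unique Φ
    width         : All (IsKClause k) Φ
    degree-bound  : ∀ v → degree Φ v ≤ d
    overlap-bound : ∀ {c c′} → c ∈ Φ → c′ ∈ Φ → c ≢ c′ → shared c c′ ≤ s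

------------------------------------------------------------------------
-- Sampling from μ_Φ

tuples : ∀ {A : Set} T → List A → List (Vec A T)
tuples zero    xs = [] ∷ []
tuples (suc T) xs = cartesianProductWith _∷_ xs (tuples T xs)

assignments : ∀ n → List (Assignment n)
assignments n = tuples n (true ∷ false ∷ [])

#solutions : ∀ {n} → CNF n → ℕ
#solutions {n} Φ = length (filter (satisfies? Φ) (assignments n))

-- 1/0 is set to 0; it never arises in μ, whose value at a non-solution is 0.
reciprocal : ℕ → ℚ
reciprocal zero    = 0ℚ
reciprocal (suc m) = + 1 / suc m

-- Probability mass function. For unsatisfiable Φ it is identically 0, so a
-- lower bound on a probability under T ≥ 1 samples fails for such Φ.
μ : ∀ {n} → CNF n → Assignment n → ℚ
μ Φ x = if does (satisfies? Φ x) then reciprocal (#solutions Φ) else 0ℚ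

-- Mass of T independent samples.
μ^ : ∀ {n T} → CNF n → Vec (Assignment n) T → ℚ
μ^ Φ X = Vec.foldr _ ℚ._*_ 1ℚ (Vec.map (μ Φ) X)

-- Pr Φ T E? is the probability of E under T i.i.d. samples from μ_Φ.
Pr : ∀ {n} (Φ : CNF n) (T : ℕ) {E : Pred (Vec (Assignment n) T) 0ℓ} → Decidable E → ℚ
Pr {n} Φ T E? =
  foldr ℚ._+_ 0ℚ
    (map (λ X → if does (E? X) then μ^ Φ X else 0ℚ) (tuples T (assignments n)))

------------------------------------------------------------------------
-- Cost model: unit-cost random access machine. Every call of a function
-- below with result in Cost ticks once and, apart from further such calls,
-- performs a bounded number of constructor applications, case distinctions
-- and bit comparisons, and at most one array access (reading x_v from a
-- sample x).

record Cost (A : Set) : Set where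
  constructor _costing_
  field
    value : A
    steps : ℕ

open Cost public

return : ∀ {A : Set} → A → Cost A
return a = a costing 0

_>>=_ : ∀ {A B : Set} → Cost A → (A → Cost B) → Cost B
(a costing m) >>= f = value (f a) costing (m + steps (f a))

_>>_ : ∀ {A B : Set} → Cost A → Cost B → Cost B
p >> q = p >>= λ _ → q

tick : Cost ⊤
tick = tt costing 1

------------------------------------------------------------------------
-- Valiant's algorithm

-- The list 0, 1, …, n-1, produced by a counting loop.
variables : ∀ n → Cost (List (Fin n))
variables n = allFin n costing suc n

-- prepend l cs ds is map (l ∷_) cs ++ ds.
prepend : ∀ {n} → Literal n → CNF n → CNF n → Cost (CNF n)
prepend l []       ds = do
  tick
  return ds
prepend l (c ∷ cs) ds = do
  tick
  es ← prepend l cs ds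
  return ((l ∷ c) ∷ es)

-- All clauses on k distinct variables from the given list.
candidates : ∀ {n} → ℕ → List (Fin n) → Cost (CNF n)
candidates zero    vs       = do
  tick
  return ([] ∷ [])
candidates (suc k) []       = do
  tick
  return []
candidates (suc k) (v ∷ vs) = do
  tick
  cs ← candidates k vs
  ds ← candidates (suc k) vs
  es ← prepend (v , false) cs ds
  prepend (v , true) cs es

violates : ∀ {n} → Assignment n → Clause n → Cost Bool
violates x []      = do
  tick
  return true
violates x (l ∷ c) = do
  tick
  if does (holds? x l) then return false else violates x c

removeViolated : ∀ {n} → Assignment n → CNF n → Cost (CNF n)
removeViolated x []       = do
  tick
  return []
removeViolated x (c ∷ cs) = do
  tick
  b  ← violates x c
  ds ← removeViolated x cs
  return (if b then ds else c ∷ ds)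

removeAll : ∀ {n T} → Vec (Assignment n) T → CNF n → Cost (CNF n)
removeAll []      cs = do
  tick
  return cs
removeAll (x ∷ X) cs = do
  tick
  ds ← removeViolated x cs
  removeAll X ds

valiant : ∀ {n T} → ℕ → Vec (Assignment n) T → Cost (CNF n)
valiant {n} k X = do
  tick
  vs ← variables n
  cs ← candidates k vs
  removeAll X cs

-- The samples X make the algorithm output some Φ̂ with μ_Φ̂ = μ_Φ.
Learns : ∀ {n T} → ℕ → CNF n → Vec (Assignment n) T → Set
Learns {n} k Φ X = All (λ x → μ (value (valiant k X)) x ≡ μ Φ x) (assignments n)

learns? : ∀ {n T} k (Φ : CNF n) → Decidable (Learns {n} {T} k Φ)
learns? {n} k Φ X = all? (λ x → μ (value (valiant k X)) x ℚ.≟ μ Φ x) (assignments n)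

{-# OPTIONS --safe #-}
module Submission where

-- Fix a k-clause c violated by some solution τ of Φ. Pin the variables of c
-- to their values in τ. Since clauses pairwise share at most s = o(k)
-- variables, only few clauses of Φ lose more than o(k) variables; pin one more
-- variable of each of them so that τ satisfies it. The residual clauses still
-- have k - o(k) variables, so a counting form of the local lemma shows that a
-- fraction of the solutions bounded below in terms of k alone agrees with τ on
-- the pinned variables, hence violates c. Thus each non-implied clause survives
-- T samples with probability exponentially small in T, and a union bound over
-- the at most (2n)^k clauses applies. All probabilities are handled as
-- quotients of numbers of assignments.

-- A solution violates c, so c is not a clause of Φ and `s` does not bound its overlap with any
-- single clause of Φ; such a clause may have all its variables in c and leave an empty residue.
-- What helps is that clauses of this kind overlap one another in at most `s` variables. Take m =
-- `scale k`, roughly the largest m with m^m ≤ k, and q = k / m rounded down. For every fixed η the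
-- product m² s is at most k once k is large, and then m clauses that each meet c in more than ms +
-- q variables would cover more than k variables. So at most m clauses need an extra pin, and every
-- other clause loses at most ms + q + m ≤ 3q variables. The term o(k) is 4q: 3q for the lost
-- variables, and q for the factor k in the condition of the local lemma, as k ≤ 2^q. Since m is
-- defined without η, this term can be fixed before η; η enters only through the additive constant,
-- which also forces k to be large.

open import Defs
open import Data.Bool using (true; false; not; if_then_else_)
import Data.Bool.Properties as Bool
open import Data.Empty using (⊥-elim)
open import Data.Fin using (Fin; zero; suc)
import Data.Fin as Fin
import Data.Fin.Properties as Fin
open import Data.Integer using (-[1+_]) renaming (+_ to pos)
import Data.Integer as ℤ
import Data.Integer.Properties as ℤ
import Data.Integer.Tactic.RingSolver as ℤSolver
open import Data.List
  using (List; []; _∷_; _++_; map; filter; length; foldr; take; deduplicate; allFin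
        ; cartesianProductWith)
open import Data.List.Properties
  using (length-++; length-map; length-filter; length-take; length-tabulate; length-deduplicate
        ; filter-all; filter-none; filter-++; filter-accept; filter-reject; map-∘; map-id
        ; ++-identityʳ)
import Data.List.Membership.DecPropositional as DecMembership
open import Data.List.Membership.Propositional using (_∈_; _∉_; lose; find)
open import Data.List.Membership.Propositional.Properties
  using (∈-filter⁺; ∈-filter⁻; ∈-map⁺; ∈-map⁻; ∈-deduplicate⁺; ∈-deduplicate⁻; ∈-++⁺ˡ; ∈-++⁺ʳ
        ; ∈-++⁻; ∈-allFin; ∈-cartesianProductWith⁺; ∈-length)
open import Data.List.Relation.Unary.All as All using (All; []; _∷_; all?)
import Data.List.Relation.Unary.All.Properties as All
open import Data.List.Relation.Unary.AllPairs as AllPairs using (AllPairs; []; _∷_)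
import Data.List.Relation.Unary.AllPairs.Properties as AllPairs
open import Data.List.Relation.Unary.Any as Any using (Any; here; there; any?)
import Data.List.Relation.Unary.Any.Properties as Any
open import Data.List.Relation.Unary.Unique.Propositional using (Unique)
import Data.List.Relation.Unary.Unique.DecPropositional.Properties as DecUnique
import Data.List.Relation.Unary.Unique.Propositional.Properties as Unique
open import Data.Nat hiding (_/_)
import Data.Nat as ℕ
open import Data.Nat.DivMod using (m≡m%n+[m/n]*n; m%n<n; m*n/n≡m; m/n*n≤m; /-monoˡ-≤)
open import Data.Nat.ListAction using (sum)
open import Data.Nat.Properties
open import Data.Nat.Tactic.RingSolver using (solve-∀)
open import Data.Product using (∃; _×_; _,_; proj₁; proj₂)
open import Data.Rational using (ℚ; 0ℚ; 1ℚ; _/_; toℚᵘ; mkℚ)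
import Data.Rational as ℚ
import Data.Rational.Properties as ℚ
open import Data.Rational.Unnormalised using (mkℚᵘ; *≡*; *<*)
import Data.Rational.Unnormalised as ℚᵘ
import Data.Rational.Unnormalised.Properties as ℚᵘ
open import Data.Sum using (_⊎_; inj₁; inj₂)
open import Data.Vec using (Vec; []; _∷_; lookup; replicate; _[_]≔_)
open import Data.Vec.Properties using (lookup∘update′)
import Data.Vec.Relation.Unary.All as VecAll
open VecAll using ([]; _∷_)
open import Function using (_∘_; id)
open import Level using (0ℓ)
open import Relation.Binary.Definitions using (tri<; tri≈; tri>)
open import Relation.Binary.PropositionalEquality
open import Relation.Nullary using (¬_; Dec; yes; no; does; ¬?)
open import Relation.Nullary.Decidable using (_×-dec_; decidable-stable)
open import Relation.Unary using (Pred; Decidable; _∩_; ∁)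
open import Relation.Unary.Properties using (_∩?_; ∁?)

-- Counting list elements

module _ {A : Set} where

  # : {P : Pred A 0ℓ} → Decidable P → List A → ℕ
  # P? xs = length (filter P? xs)

  private variable
    P Q R : Pred A 0ℓ

  #-mono : (P? : Decidable P) (Q? : Decidable Q) → (∀ {x} → P x → Q x) → ∀ xs → # P? xs ≤ # Q? xs
  #-mono P? Q? f [] = z≤n
  #-mono P? Q? f (x ∷ xs) with P? x | Q? x
  ... | yes _ | yes _ = s≤s (#-mono P? Q? f xs)
  ... | yes p | no ¬q = ⊥-elim (¬q (f p))
  ... | no _  | yes _ = m≤n⇒m≤1+n (#-mono P? Q? f xs)
  ... | no _  | no _  = #-mono P? Q? f xs

  #-cong : (P? : Decidable P) (Q? : Decidable Q) → (∀ {x} → P x → Q x) → (∀ {x} → Q x → P x) →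
           ∀ xs → # P? xs ≡ # Q? xs
  #-cong P? Q? f g xs = ≤-antisym (#-mono P? Q? f xs) (#-mono Q? P? g xs)

  #-split : (P? : Decidable P) (Q? : Decidable Q) → ∀ xs →
            # P? xs ≡ # (P? ∩? Q?) xs + # (P? ∩? ∁? Q?) xs
  #-split P? Q? [] = refl
  #-split P? Q? (x ∷ xs) with P? x | Q? x
  ... | yes _ | yes _ = cong suc (#-split P? Q? xs)
  ... | yes _ | no _  = trans (cong suc (#-split P? Q? xs)) (sym (+-suc _ _))
  ... | no _  | yes _ = #-split P? Q? xs
  ... | no _  | no _  = #-split P? Q? xs

  #-union : (P? : Decidable P) (Q? : Decidable Q) (R? : Decidable R) →
            (∀ {x} → P x → ¬ Q x → R x) → ∀ xs → # P? xs ≤ # Q? xs + # R? xs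
  #-union P? Q? R? f xs = begin
    # P? xs                                   ≡⟨ #-split P? Q? xs ⟩
    # (P? ∩? Q?) xs + # (P? ∩? ∁? Q?) xs      ≤⟨ +-mono-≤ (#-mono (P? ∩? Q?) Q? proj₂ xs)
                                                   (#-mono (P? ∩? ∁? Q?) R? (λ (p , ¬q) → f p ¬q) xs) ⟩
    # Q? xs + # R? xs                         ∎
    where open ≤-Reasoning

  #-all : (P? : Decidable P) → (∀ x → P x) → ∀ xs → # P? xs ≡ length xs
  #-all P? p xs = cong length (filter-all P? (All.universal p xs))

  #-none : (P? : Decidable P) → (∀ x → ¬ P x) → ∀ xs → # P? xs ≡ 0
  #-none P? ¬p xs = cong length (filter-none P? (All.universal ¬p xs))

  #-++ : (P? : Decidable P) → ∀ xs ys → # P? (xs ++ ys) ≡ # P? xs + # P? ys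
  #-++ P? xs ys = trans (cong length (filter-++ P? xs ys)) (length-++ (filter P? xs))

  #-filter : (P? : Decidable P) (Q? : Decidable Q) → ∀ xs → # P? (filter Q? xs) ≡ # (P? ∩? Q?) xs
  #-filter P? Q? [] = refl
  #-filter P? Q? (x ∷ xs) with Q? x
  ... | no _ with P? x
  ...   | yes _ = #-filter P? Q? xs
  ...   | no _  = #-filter P? Q? xs
  #-filter P? Q? (x ∷ xs) | yes _ with P? x
  ...   | yes _ = cong suc (#-filter P? Q? xs)
  ...   | no _  = #-filter P? Q? xs

  #-∷ : {P : Pred A 0ℓ} (P? : Decidable P) → ∀ x xs → # P? xs ≤ # P? (x ∷ xs)
  #-∷ P? x xs with P? x
  ... | yes _ = n≤1+n _
  ... | no _  = ≤-refl

  #-complement : {P : Pred A 0ℓ} (P? : Decidable P) → ∀ xs → # P? xs + # (∁? P?) xs ≡ length xs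
  #-complement P? [] = refl
  #-complement P? (x ∷ xs) with P? x
  ... | yes _ = cong suc (#-complement P? xs)
  ... | no _  = trans (+-suc _ _) (cong suc (#-complement P? xs))

  -- Lets a formula be reordered so that the clauses meeting a given set of variables stand in
  -- front, where the local lemma can strip them off one by one, without changing any degree.
  #-partition : {P Q : Pred A 0ℓ} (P? : Decidable P) (Q? : Decidable Q) → ∀ xs →
                # P? (filter Q? xs ++ filter (∁? Q?) xs) ≡ # P? xs
  #-partition P? Q? xs = begin
    # P? (filter Q? xs ++ filter (∁? Q?) xs)            ≡⟨ #-++ P? (filter Q? xs) _ ⟩
    # P? (filter Q? xs) + # P? (filter (∁? Q?) xs)      ≡⟨ cong₂ _+_ (#-filter P? Q? xs) (#-filter P? (∁? Q?) xs) ⟩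
    # (P? ∩? Q?) xs + # (P? ∩? ∁? Q?) xs                ≡⟨ #-split P? Q? xs ⟨
    # P? xs                                             ∎
    where open ≡-Reasoning

  All-partition⁻ : {P Q : Pred A 0ℓ} (Q? : Decidable Q) → ∀ xs →
                   All P (filter Q? xs ++ filter (∁? Q?) xs) → All P xs
  All-partition⁻ Q? xs ps = All.filter⁻ Q? (All.++⁻ˡ (filter Q? xs) ps) (All.++⁻ʳ (filter Q? xs) ps)

  All-partition⁺ : {P Q : Pred A 0ℓ} (Q? : Decidable Q) → ∀ xs →
                   All P xs → All P (filter Q? xs ++ filter (∁? Q?) xs)
  All-partition⁺ Q? xs ps = All.++⁺ (All.filter⁺ Q? ps) (All.filter⁺ (∁? Q?) ps)

  #-filter-≤ : {P Q : Pred A 0ℓ} (P? : Decidable P) (Q? : Decidable Q) → ∀ xs → # P? (filter Q? xs) ≤ # P? xs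
  #-filter-≤ P? Q? xs = ≤-trans (≤-reflexive (#-filter P? Q? xs)) (#-mono (P? ∩? Q?) P? proj₁ xs)

  -- The union bound. It serves both for clauses meeting a set of variables and for sample tuples
  -- that leave some wrong clause in place.
  #-any : ∀ {B : Set} {R : B → Pred A 0ℓ} (P? : Decidable P) (R? : ∀ b → Decidable (R b)) (bs : List B) →
          (∀ {x} → P x → Any (λ b → R b x) bs) →
          ∀ xs → # P? xs ≤ sum (map (λ b → # (R? b) xs) bs)
  #-any P? R? [] f xs = ≤-reflexive (#-none P? (λ _ p → no-any (f p)) xs)
    where no-any : ∀ {B : Set} {S : Pred B 0ℓ} → ¬ Any S []
          no-any ()
  #-any {P = P} {R = R} P? R? (b ∷ bs) f xs =
    ≤-trans (#-union P? (R? b) R′? (λ p ¬q → p , ¬q) xs)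
            (+-monoʳ-≤ (# (R? b) xs) (#-any R′? R? bs g xs))
    where
    R′? : Decidable (P ∩ ∁ (R b))
    R′? = P? ∩? ∁? (R? b)
    g : ∀ {x} → (P ∩ ∁ (R b)) x → Any (λ b → R b x) bs
    g (p , ¬q) with f p
    ... | here q  = ⊥-elim (¬q q)
    ... | there a = a

#-map : ∀ {A B : Set} {P : Pred B 0ℓ} (P? : Decidable P) (g : A → B) →
        ∀ xs → # P? (map g xs) ≡ # (P? ∘ g) xs
#-map P? g [] = refl
#-map P? g (x ∷ xs) with P? (g x)
... | yes _ = cong suc (#-map P? g xs)
... | no _  = #-map P? g xs

sum-map-≤ : ∀ {A : Set} (f : A → ℕ) {m} → ∀ xs → (∀ x → f x ≤ m) → sum (map f xs) ≤ length xs * m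
sum-map-≤ f []       h = z≤n
sum-map-≤ f (x ∷ xs) h = +-mono-≤ (h x) (sum-map-≤ f xs h)

sum-map-+-≤ : ∀ {A : Set} (f g h : A → ℕ) {s} xs → All (λ x → f x ≤ g x + h x × h x ≤ s) xs →
              sum (map f xs) ≤ sum (map g xs) + length xs * s
sum-map-+-≤ f g h []       []       = z≤n
sum-map-+-≤ f g h {s} (x ∷ xs) ((f≤ , h≤) ∷ hs) = begin
  f x + sum (map f xs)
    ≤⟨ +-mono-≤ (≤-trans f≤ (+-monoʳ-≤ (g x) h≤)) (sum-map-+-≤ f g h xs hs) ⟩
  (g x + s) + (sum (map g xs) + length xs * s)
    ≡⟨ rearrange (g x) s _ _ ⟩
  (g x + sum (map g xs)) + (s + length xs * s) ∎
  where
  open ≤-Reasoning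
  rearrange : ∀ a b c d → (a + b) + (c + d) ≡ (a + c) + (b + d)
  rearrange = solve-∀

sum-map-≥ : ∀ {A : Set} (f : A → ℕ) {t} xs → All (λ x → t ≤ f x) xs → length xs * t ≤ sum (map f xs)
sum-map-≥ f []       []       = z≤n
sum-map-≥ f (x ∷ xs) (h ∷ hs) = +-mono-≤ h (sum-map-≥ f xs hs)

unique-AllPairs : ∀ {A : Set} {R : A → A → Set} xs → Unique xs →
                  (∀ {x y} → x ∈ xs → y ∈ xs → x ≢ y → R x y) → AllPairs R xs
unique-AllPairs []       []         r = []
unique-AllPairs (x ∷ xs) (x∉ ∷ uxs) r =
  All.tabulate (λ y∈ → r (here refl) (there y∈) (All.lookup x∉ y∈)) ∷
  unique-AllPairs xs uxs (λ x∈ y∈ → r (there x∈) (there y∈))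

-- Independence of literals

-- Independence of the variable `v`, as closure under resetting it. The converse implication comes
-- for free, by resetting `v` to its old value.
Ignores : ∀ {n} → Fin n → Pred (Assignment n) 0ℓ → Set
Ignores v P = ∀ x b → P x → P (x [ v ]≔ b)

#-assignments : ∀ {n} {P : Pred (Assignment (suc n)) 0ℓ} (P? : Decidable P) →
                # P? (assignments (suc n)) ≡
                # (P? ∘ (true ∷_)) (assignments n) + # (P? ∘ (false ∷_)) (assignments n)
#-assignments {n} P? = begin
  # P? (map (true ∷_) xs ++ (map (false ∷_) xs ++ []))
    ≡⟨ #-++ P? (map (true ∷_) xs) _ ⟩
  # P? (map (true ∷_) xs) + # P? (map (false ∷_) xs ++ [])
    ≡⟨ cong₂ _+_ (#-map P? (true ∷_) xs)
         (trans (cong (# P?) (++-identityʳ (map (false ∷_) xs))) (#-map P? (false ∷_) xs)) ⟩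
  # (P? ∘ (true ∷_)) xs + # (P? ∘ (false ∷_)) xs ∎
  where
  open ≡-Reasoning
  xs = assignments n

-- Flipping `v` exchanges the members of `P` with `v` true and those with `v` false. The list
-- `assignments` splits on the first variable, so the induction descends to the position of `v`,
-- where `swap` matches the two halves.
#-literal : ∀ {n} {P : Pred (Assignment n) 0ℓ} (P? : Decidable P) (v : Fin n) b → Ignores v P →
            # (P? ∩? (λ x → holds? x (v , b))) (assignments n) * 2 ≡ # P? (assignments n)
#-literal {suc n} {P} P? zero b ig = begin
  # (E? b) (assignments (suc n)) * 2                     ≡⟨ cong (_* 2) (#-assignments (E? b)) ⟩
  (# (E? b ∘ (true ∷_)) xs + # (E? b ∘ (false ∷_)) xs) * 2 ≡⟨ half b ⟩
  # (P? ∘ (true ∷_)) xs + # (P? ∘ (false ∷_)) xs     ≡⟨ #-assignments P? ⟨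
  # P? (assignments (suc n))                         ∎
  where
  open ≡-Reasoning
  xs = assignments n
  E? : ∀ b → Decidable (P ∩ λ x → Holds x (zero , b))
  E? b = P? ∩? (λ x → holds? x (zero , b))
  swap : # (P? ∘ (true ∷_)) xs ≡ # (P? ∘ (false ∷_)) xs
  swap = #-cong (P? ∘ (true ∷_)) (P? ∘ (false ∷_)) (λ {x} → ig (true ∷ x) false) (λ {x} → ig (false ∷ x) true) xs
  half : ∀ b → (# (E? b ∘ (true ∷_)) xs + # (E? b ∘ (false ∷_)) xs) * 2 ≡
         # (P? ∘ (true ∷_)) xs + # (P? ∘ (false ∷_)) xs
  half true = begin
    (# (E? true ∘ (true ∷_)) xs + # (E? true ∘ (false ∷_)) xs) * 2
      ≡⟨ cong₂ (λ i j → (i + j) * 2)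
           (#-cong (E? true ∘ (true ∷_)) (P? ∘ (true ∷_)) proj₁ (_, refl) xs)
           (#-none (E? true ∘ (false ∷_)) (λ { x (_ , ()) }) xs) ⟩
    (# (P? ∘ (true ∷_)) xs + 0) * 2
      ≡⟨ double (# (P? ∘ (true ∷_)) xs) ⟩
    # (P? ∘ (true ∷_)) xs + # (P? ∘ (true ∷_)) xs
      ≡⟨ cong (# (P? ∘ (true ∷_)) xs +_) swap ⟩
    # (P? ∘ (true ∷_)) xs + # (P? ∘ (false ∷_)) xs ∎
    where
    double : ∀ i → (i + 0) * 2 ≡ i + i
    double = solve-∀
  half false = begin
    (# (E? false ∘ (true ∷_)) xs + # (E? false ∘ (false ∷_)) xs) * 2
      ≡⟨ cong₂ (λ i j → (i + j) * 2)
           (#-none (E? false ∘ (true ∷_)) (λ { x (_ , ()) }) xs)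
           (#-cong (E? false ∘ (false ∷_)) (P? ∘ (false ∷_)) proj₁ (_, refl) xs) ⟩
    # (P? ∘ (false ∷_)) xs * 2
      ≡⟨ double (# (P? ∘ (false ∷_)) xs) ⟩
    # (P? ∘ (false ∷_)) xs + # (P? ∘ (false ∷_)) xs
      ≡⟨ cong (_+ # (P? ∘ (false ∷_)) xs) swap ⟨
    # (P? ∘ (true ∷_)) xs + # (P? ∘ (false ∷_)) xs ∎
    where
    double : ∀ i → i * 2 ≡ i + i
    double = solve-∀
#-literal {suc n} {P} P? (suc v) b ig = begin
  # E? (assignments (suc n)) * 2
    ≡⟨ cong (_* 2) (#-assignments E?) ⟩
  (# (E? ∘ (true ∷_)) xs + # (E? ∘ (false ∷_)) xs) * 2
    ≡⟨ *-distribʳ-+ 2 (# (E? ∘ (true ∷_)) xs) _ ⟩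
  # (E? ∘ (true ∷_)) xs * 2 + # (E? ∘ (false ∷_)) xs * 2
    ≡⟨ cong₂ _+_ (#-literal (P? ∘ (true ∷_)) v b (λ x → ig (true ∷ x)))
                 (#-literal (P? ∘ (false ∷_)) v b (λ x → ig (false ∷ x))) ⟩
  # (P? ∘ (true ∷_)) xs + # (P? ∘ (false ∷_)) xs
    ≡⟨ #-assignments P? ⟨
  # P? (assignments (suc n)) ∎
  where
  open ≡-Reasoning
  xs = assignments n
  E? = P? ∩? (λ x → holds? x (suc v , b))

holds-update : ∀ {n} (x : Assignment n) {v} {b} (l : Literal n) → v ≢ proj₁ l →
               Holds x l → Holds (x [ v ]≔ b) l
holds-update x {v} {b} (u , _) v≢u h = trans (lookup∘update′ (v≢u ∘ sym) x b) h

allHold-ignores : ∀ {n} {v : Fin n} (L : Clause n) → All (v ≢_) (vbl L) →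
                  Ignores v (λ x → All (Holds x) L)
allHold-ignores [] [] x b [] = []
allHold-ignores (l ∷ L) (v≢l ∷ v∉L) x b (h ∷ hs) =
  holds-update x l v≢l h ∷ allHold-ignores L v∉L x b hs

-- A conjunction of literals on other variables still ignores `v`, so the literals can be split off
-- one at a time, each halving the count.
#-literals : ∀ {n} {P : Pred (Assignment n) 0ℓ} (P? : Decidable P) (L : Clause n) →
             Unique (vbl L) → All (λ v → Ignores v P) (vbl L) →
             # (P? ∩? (λ x → all? (holds? x) L)) (assignments n) * 2 ^ length L ≡ # P? (assignments n)
#-literals {n} P? [] _ _ =
  trans (*-identityʳ _) (#-cong (P? ∩? _) P? proj₁ (_, []) (assignments n))
#-literals {n} {P} P? ((v , b) ∷ L) (v∉L ∷ uL) (ig ∷ igs) = begin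
  # E? xs * (2 * 2 ^ length L)
    ≡⟨ *-assoc (# E? xs) 2 _ ⟨
  # E? xs * 2 * 2 ^ length L
    ≡⟨ cong (λ i → i * 2 * 2 ^ length L)
         (#-cong E? (Q? ∩? (λ x → holds? x (v , b)))
           (λ { (p , h ∷ hs) → (p , hs) , h }) (λ { ((p , hs) , h) → p , h ∷ hs }) xs) ⟩
  # (Q? ∩? (λ x → holds? x (v , b))) xs * 2 * 2 ^ length L
    ≡⟨ cong (_* 2 ^ length L)
         (#-literal Q? v b (λ x b (p , hs) → ig x b p , allHold-ignores L v∉L x b hs)) ⟩
  # Q? xs * 2 ^ length L
    ≡⟨ #-literals P? L uL igs ⟩
  # P? xs ∎
  where
  open ≡-Reasoning
  xs = assignments n
  E? = P? ∩? (λ x → all? (holds? x) ((v , b) ∷ L))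
  Q? = P? ∩? (λ x → all? (holds? x) L)

clause? : ∀ {n} (c : Clause n) → Decidable (λ (x : Assignment n) → Any (Holds x) c)
clause? c x = any? (holds? x) c

violated? : ∀ {n} (c : Clause n) → Decidable (λ (x : Assignment n) → ¬ Any (Holds x) c)
violated? c = ∁? (clause? c)

negate : ∀ {n} → Clause n → Clause n
negate = map (λ (v , b) → v , not b)

vbl-negate : ∀ {n} (c : Clause n) → vbl (negate c) ≡ vbl c
vbl-negate []      = refl
vbl-negate (l ∷ c) = cong (_ ∷_) (vbl-negate c)

violates⇒negate : ∀ {n} (x : Assignment n) c → ¬ Any (Holds x) c → All (Holds x) (negate c)
violates⇒negate x []            _ = []
violates⇒negate x ((v , b) ∷ c) ¬h =
  Bool.¬-not (¬h ∘ here) ∷ violates⇒negate x c (¬h ∘ there)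

-- Violating `c` fixes each of its variables to the opposite of its literal, which has probability
-- 2^-|c| independently of `P`.
#-violated : ∀ {n} {P : Pred (Assignment n) 0ℓ} (P? : Decidable P) (c : Clause n) →
             Unique (vbl c) → All (λ v → Ignores v P) (vbl c) →
             # (P? ∩? violated? c) (assignments n) * 2 ^ length c ≤ # P? (assignments n)
#-violated {n} P? c u ig = begin
  # (P? ∩? violated? c) xs * 2 ^ length c
    ≤⟨ *-monoˡ-≤ (2 ^ length c) (#-mono (P? ∩? violated? c) E? (λ {x} (p , ¬h) → p , violates⇒negate x c ¬h) xs) ⟩
  # E? xs * 2 ^ length c
    ≡⟨ cong (λ i → # E? xs * 2 ^ i) (length-map _ c) ⟨
  # E? xs * 2 ^ length (negate c)
    ≡⟨ #-literals P? (negate c) (subst Unique (sym (vbl-negate c)) u)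
         (subst (All _) (sym (vbl-negate c)) ig) ⟩
  # P? xs ∎
  where
  open ≤-Reasoning
  xs = assignments n
  E? = P? ∩? (λ x → all? (holds? x) (negate c))

-- The local lemma for counts

module _ {n : ℕ} where
  open DecMembership (Fin._≟_ {n}) using (_∈?_)

  Touches : List (Fin n) → Clause n → Set
  Touches W c = Any (λ v → v ∈ vbl c) W

  touches? : ∀ W → Decidable (Touches W)
  touches? W c = any? (_∈? vbl c) W

  #-touching : ∀ (W : List (Fin n)) Ψ {d} → (∀ v → degree Ψ v ≤ d) → # (touches? W) Ψ ≤ length W * d
  #-touching W Ψ deg = ≤-trans
    (#-any (touches? W) (λ v c → v ∈? vbl c) W id Ψ)
    (sum-map-≤ (degree Ψ) W deg)

  clause-ignores : ∀ {v} (c : Clause n) → v ∉ vbl c → Ignores v (λ x → Any (Holds x) c)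
  clause-ignores (l ∷ c) v∉ x b (here h)  = here (holds-update x l (v∉ ∘ here) h)
  clause-ignores (l ∷ c) v∉ x b (there h) = there (clause-ignores c (v∉ ∘ there) x b h)

  satisfies-ignores : ∀ {v} (Ψ : CNF n) → All (λ c → v ∉ vbl c) Ψ → Ignores v (Satisfies Ψ)
  satisfies-ignores []      []         x b []       = []
  satisfies-ignores (c ∷ Ψ) (v∉c ∷ v∉) x b (h ∷ hs) =
    clause-ignores c v∉c x b h ∷ satisfies-ignores Ψ v∉ x b hs

  untouched-ignores : ∀ {W} Ψ → All (λ c → ¬ Touches W c) Ψ → All (λ v → Ignores v (Satisfies Ψ)) W
  untouched-ignores Ψ h = All.tabulate (λ v∈W → satisfies-ignores Ψ (All.map (λ ¬t v∈c → ¬t (lose v∈W v∈c)) h))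

  record IsLocal (k d w : ℕ) (Ψ : CNF n) : Set where
    field
      width  : All (λ c → length c ≤ k × w ≤ length c × Unique (vbl c)) Ψ
      degree-bound : ∀ v → degree Ψ v ≤ d

  open IsLocal

  tail-local : ∀ {k d w c Ψ} → IsLocal k d w (c ∷ Ψ) → IsLocal k d w Ψ
  tail-local loc .width = All.tail (loc .width)
  tail-local {c = c} {Ψ} loc .degree-bound v = ≤-trans (#-∷ _ c Ψ) (loc .degree-bound v)

  partition-local : ∀ {k d w} {Q : Pred (Clause n) 0ℓ} (Q? : Decidable Q) Ψ → IsLocal k d w Ψ →
                    IsLocal k d w (filter Q? Ψ ++ filter (∁? Q?) Ψ)
  partition-local Q? Ψ loc .width = All-partition⁺ Q? Ψ (loc .width)
  partition-local Q? Ψ loc .degree-bound v =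
    ≤-trans (≤-reflexive (#-partition (λ c → v ∈? vbl c) Q? Ψ)) (loc .degree-bound v)

  #solutions-∷ : ∀ c (Ψ : CNF n) →
    #solutions Ψ ≡ #solutions (c ∷ Ψ) + # (satisfies? Ψ ∩? violated? c) (assignments n)
  #solutions-∷ c Ψ = trans (#-split (satisfies? Ψ) (clause? c) (assignments n))
    (cong (_+ # (satisfies? Ψ ∩? violated? c) (assignments n))
      (#-cong (satisfies? Ψ ∩? clause? c) (satisfies? (c ∷ Ψ))
        (λ (hs , h) → h ∷ hs) (λ { (h ∷ hs) → hs , h }) (assignments n)))

  #solutions-++ : ∀ (Φ Ψ : CNF n) → #solutions (Φ ++ Ψ) ≤ #solutions Ψ
  #solutions-++ Φ Ψ = #-mono (satisfies? (Φ ++ Ψ)) (satisfies? Ψ) (All.++⁻ʳ Φ) (assignments n)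

  module LocalLemma {k d w : ℕ} (4kd≤2^w : 4 * (k * d) ≤ 2 ^ w) where

    -- The conditional probability of violating c is at most 2 / 2^w.
    Unlikely : CNF n → Clause n → Set
    Unlikely Ψ c = # (satisfies? Ψ ∩? violated? c) (assignments n) * 2 ^ w ≤ 2 * #solutions Ψ

    -- Adding the clauses of `Δ` one by one, each removes at most a fraction 2 / 2^w of the current
    -- solutions, hence of those of `Ψ`; the total loss is linear in `length Δ`. The induction
    -- hypothesis of the local lemma is an argument, restricted to formulas with fewer than `ℓ`
    -- clauses.
    chain : ∀ ℓ → (∀ {Ψ c} → length Ψ < ℓ → IsLocal k d w (c ∷ Ψ) → Unlikely Ψ c) →
            ∀ Δ Ψ → length (Δ ++ Ψ) ≤ ℓ → IsLocal k d w (Δ ++ Ψ) →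
            #solutions Ψ * 2 ^ w ≤ #solutions (Δ ++ Ψ) * 2 ^ w + length Δ * (2 * #solutions Ψ)
    chain ℓ unlikely []      Ψ _ _ = m≤m+n _ _
    chain ℓ unlikely (c ∷ Δ) Ψ l loc = begin
      N * W
        ≤⟨ chain ℓ unlikely Δ Ψ (<⇒≤ l) (tail-local loc) ⟩
      #solutions (Δ ++ Ψ) * W + length Δ * (2 * N)
        ≡⟨ cong (λ i → i * W + length Δ * (2 * N)) (#solutions-∷ c (Δ ++ Ψ)) ⟩
      (S + V) * W + length Δ * (2 * N)
        ≡⟨ cong (_+ length Δ * (2 * N)) (*-distribʳ-+ W S V) ⟩
      S * W + V * W + length Δ * (2 * N)
        ≤⟨ +-monoˡ-≤ _ (+-monoʳ-≤ (S * W) (≤-trans (unlikely l loc)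
             (*-monoʳ-≤ 2 (#solutions-++ Δ Ψ)))) ⟩
      S * W + 2 * N + length Δ * (2 * N)
        ≡⟨ +-assoc (S * W) (2 * N) _ ⟩
      S * W + (2 * N + length Δ * (2 * N)) ∎
      where
      open ≤-Reasoning
      N = #solutions Ψ
      W = 2 ^ w
      S = #solutions (c ∷ Δ ++ Ψ)
      V = # (satisfies? (Δ ++ Ψ) ∩? violated? c) (assignments n)

    -- The symmetric local lemma with p = 2^-w and at most kd neighbours, 4pkd ≤ 1. Induction on a
    -- bound for the number of clauses: the clauses `F` disjoint from `c` are independent of it, so
    -- among their solutions `c` fails with probability at most p. Restoring the neighbours `R`
    -- loses at most half of these solutions by `chain`, which doubles p.
    unlikely : ∀ ℓ {Ψ c} → length Ψ < ℓ → IsLocal k d w (c ∷ Ψ) → Unlikely Ψ c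
    unlikely (suc ℓ) {Ψ} {c} (s≤s l) loc with loc .width
    ... | (c≤k , w≤c , uc) ∷ _ = begin
      V * W                              ≤⟨ *-mono-≤ (#-mono (satisfies? Ψ ∩? violated? c) (satisfies? F ∩? violated? c)
                                              (λ (hs , h) → All.filter⁺ (∁? T?) hs , h) xs)
                                              (^-monoʳ-≤ 2 w≤c) ⟩
      V′ * 2 ^ length c                  ≤⟨ #-violated (satisfies? F) c uc
                                              (untouched-ignores F (All.all-filter (∁? T?) Ψ)) ⟩
      N                                  ≤⟨ *-cancelʳ-≤ N (2 * M) W {{m^n≢0 2 w}} (+-cancelʳ-≤ (N * W) _ _ step) ⟩
      2 * M ∎
      where
      open ≤-Reasoning
      xs = assignments n
      W = 2 ^ w
      T? = touches? (vbl c)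
      R = filter T? Ψ
      F = filter (∁? T?) Ψ
      V = # (satisfies? Ψ ∩? violated? c) xs
      V′ = # (satisfies? F ∩? violated? c) xs
      N = #solutions F
      M = #solutions Ψ
      locΨ : IsLocal k d w Ψ
      locΨ = tail-local loc
      R≤kd : length R ≤ k * d
      R≤kd = ≤-trans (#-touching (vbl c) Ψ (locΨ .degree-bound))
               (*-monoˡ-≤ d (≤-trans (≤-reflexive (length-map proj₁ c)) c≤k))
      RF≤ℓ : length (R ++ F) ≤ ℓ
      RF≤ℓ = ≤-trans (≤-reflexive (trans (length-++ R) (#-complement T? Ψ))) l
      rearrange₁ : ∀ N W → N * W + N * W ≡ 2 * (N * W)
      rearrange₁ = solve-∀
      rearrange₂ : ∀ M W r N → 2 * (M * W + r * (2 * N)) ≡ 2 * M * W + N * (4 * r)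
      rearrange₂ = solve-∀
      -- The loss `length R * (2 * N)` is at most half of `N * W`; doubling the bound of `chain`
      -- avoids the fraction and leaves one `N * W` to cancel.
      step : N * W + N * W ≤ 2 * M * W + N * W
      step = begin
        N * W + N * W
          ≡⟨ rearrange₁ N W ⟩
        2 * (N * W)
          ≤⟨ *-monoʳ-≤ 2 (chain ℓ (unlikely ℓ) R F RF≤ℓ (partition-local T? Ψ locΨ)) ⟩
        2 * (#solutions (R ++ F) * W + length R * (2 * N))
          ≤⟨ *-monoʳ-≤ 2 (+-monoˡ-≤ _ (*-monoˡ-≤ W
               (#-mono (satisfies? (R ++ F)) (satisfies? Ψ) (All-partition⁻ T? Ψ) xs))) ⟩
        2 * (M * W + length R * (2 * N))
          ≡⟨ rearrange₂ M W (length R) N ⟩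
        2 * M * W + N * (4 * length R)
          ≤⟨ +-monoʳ-≤ (2 * M * W) (*-monoʳ-≤ N (≤-trans (*-monoʳ-≤ 4 R≤kd) 4kd≤2^w)) ⟩
        2 * M * W + N * W ∎

    -- Each added clause is violated with conditional probability at most 2 / 2^w ≤ 1/2. Unlike the
    -- linear loss in `chain`, this product form stays meaningful for a `Δ` of any length.
    #solutions-halving : 4 ≤ 2 ^ w → ∀ Δ Ψ → IsLocal k d w (Δ ++ Ψ) →
                         #solutions Ψ ≤ 2 ^ length Δ * #solutions (Δ ++ Ψ)
    #solutions-halving 4≤2^w []      Ψ loc = ≤-reflexive (sym (*-identityˡ _))
    #solutions-halving 4≤2^w (c ∷ Δ) Ψ loc = begin
      #solutions Ψ                             ≤⟨ #solutions-halving 4≤2^w Δ Ψ (tail-local loc) ⟩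
      2 ^ length Δ * M                         ≤⟨ *-monoʳ-≤ (2 ^ length Δ) M≤2S ⟩
      2 ^ length Δ * (2 * S)                   ≡⟨ rearrange (2 ^ length Δ) S ⟩
      2 * 2 ^ length Δ * S                     ∎
      where
      open ≤-Reasoning
      M = #solutions (Δ ++ Ψ)
      S = #solutions (c ∷ Δ ++ Ψ)
      V = # (satisfies? (Δ ++ Ψ) ∩? violated? c) (assignments n)
      rearrange : ∀ i j → i * (2 * j) ≡ 2 * i * j
      rearrange = solve-∀
      2V≤M : V * 2 ≤ M
      2V≤M = *-cancelˡ-≤ 2 (begin
        2 * (V * 2) ≡⟨ rearrange₃ V ⟩
        V * 4       ≤⟨ *-monoʳ-≤ V 4≤2^w ⟩
        V * 2 ^ w   ≤⟨ unlikely (suc (length (Δ ++ Ψ))) ≤-refl loc ⟩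
        2 * M       ∎)
        where
        rearrange₃ : ∀ V → 2 * (V * 2) ≡ V * 4
        rearrange₃ = solve-∀
      M≤2S : M ≤ 2 * S
      M≤2S = +-cancelʳ-≤ M M (2 * S) (begin
        M + M             ≡⟨ cong₂ _+_ (#solutions-∷ c (Δ ++ Ψ)) (#solutions-∷ c (Δ ++ Ψ)) ⟩
        (S + V) + (S + V) ≡⟨ rearrange₄ S V ⟩
        2 * S + V * 2     ≤⟨ +-monoʳ-≤ (2 * S) 2V≤M ⟩
        2 * S + M         ∎)
        where
        rearrange₄ : ∀ S V → (S + V) + (S + V) ≡ 2 * S + V * 2
        rearrange₄ = solve-∀

-- Pinning

module _ {n : ℕ} where
  open DecMembership (Fin._≟_ {n}) using (_∈?_)

  #-≟ : ∀ (v : Fin n) {us} → Unique us → # (Fin._≟ v) us ≤ 1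
  #-≟ v [] = z≤n
  #-≟ v {u ∷ us} (u∉us ∷ uus) with u Fin.≟ v
  ... | no _     = #-≟ v uus
  ... | yes refl = s≤s (≤-reflexive (zero-count u∉us))
    where
    zero-count : ∀ {us} → All (v ≢_) us → # (Fin._≟ v) us ≡ 0
    zero-count [] = refl
    zero-count {u ∷ _} (v≢u ∷ h) with u Fin.≟ v
    ... | yes u≡v = ⊥-elim (v≢u (sym u≡v))
    ... | no _    = zero-count h

  #-∈-≤ : ∀ vs {us : List (Fin n)} → Unique us → # (_∈? vs) us ≤ length vs
  #-∈-≤ vs {us} uus = begin
    # (_∈? vs) us                          ≤⟨ #-any (_∈? vs) (λ v u → u Fin.≟ v) vs id us ⟩
    sum (map (λ v → # (Fin._≟ v) us) vs)   ≤⟨ sum-map-≤ _ vs (λ v → #-≟ v uus) ⟩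
    length vs * 1                          ≡⟨ *-identityʳ _ ⟩
    length vs                              ∎
    where open ≤-Reasoning

  length-⊆ : ∀ {us vs : List (Fin n)} → Unique us → All (_∈ vs) us → length us ≤ length vs
  length-⊆ {us} {vs} uus us⊆vs =
    ≤-trans (≤-reflexive (cong length (sym (filter-all (_∈? vs) us⊆vs)))) (#-∈-≤ vs uus)

  shared-comm-≤ : ∀ {us : List (Fin n)} vs → Unique us → # (_∈? vs) us ≤ # (_∈? us) vs
  shared-comm-≤ {us} vs uus = length-⊆ (Unique.filter⁺ (_∈? vs) uus)
    (All.tabulate (λ v∈ → let v∈us , v∈vs = ∈-filter⁻ (_∈? vs) {xs = us} v∈ in ∈-filter⁺ (_∈? us) v∈vs v∈us))

  -- Restrict to the variables of `U` outside the first clause: each later clause loses at most `s`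
  -- variables by this. The square in place of the number of pairs absorbs these losses in the
  -- induction.
  bonferroni : ∀ {s} (U : List (Fin n)) (Ψ : CNF n) → Unique U →
               AllPairs (λ c c′ → shared c c′ ≤ s) Ψ →
               sum (map (λ c → # (_∈? vbl c) U) Ψ) ≤ length U + length Ψ * length Ψ * s
  bonferroni U [] uU [] = z≤n
  bonferroni {s} U (c ∷ Ψ) uU (sh ∷ shs) = begin
    # C? U + sum (map (λ c′ → # (_∈? vbl c′) U) Ψ)
      ≤⟨ +-monoʳ-≤ (# C? U) (sum-map-+-≤ _ _ (λ c′ → # (_∈? vbl c′) (filter C? U)) Ψ
           (All.map (λ {c′} h → split c′ , overlapping c′ h) sh)) ⟩
    # C? U + (sum (map (λ c′ → # (_∈? vbl c′) U′) Ψ) + ℓ * s)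
      ≤⟨ +-monoʳ-≤ (# C? U) (+-monoˡ-≤ _ (bonferroni U′ Ψ (Unique.filter⁺ (∁? C?) uU) shs)) ⟩
    # C? U + (length U′ + ℓ * ℓ * s + ℓ * s)
      ≡⟨ rearrange (# C? U) (length U′) ℓ s ⟩
    (# C? U + length U′) + (ℓ * ℓ * s + ℓ * s)
      ≤⟨ +-mono-≤ (≤-reflexive (#-complement C? U)) (m≤m+n _ (suc ℓ * s)) ⟩
    length U + (ℓ * ℓ * s + ℓ * s + suc ℓ * s)
      ≡⟨ cong (length U +_) (square ℓ s) ⟩
    length U + suc ℓ * suc ℓ * s ∎
    where
    open ≤-Reasoning
    C? = _∈? vbl c
    ℓ = length Ψ
    U′ = filter (∁? C?) U
    split : ∀ c′ → # (_∈? vbl c′) U ≤ # (_∈? vbl c′) U′ + # (_∈? vbl c′) (filter C? U)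
    split c′ = ≤-reflexive (trans (#-split (_∈? vbl c′) C? U) (trans (+-comm (# ((_∈? vbl c′) ∩? C?) U) _)
      (cong₂ _+_ (sym (#-filter (_∈? vbl c′) (∁? C?) U)) (sym (#-filter (_∈? vbl c′) C? U)))))
    overlapping : ∀ c′ → shared c c′ ≤ s → # (_∈? vbl c′) (filter C? U) ≤ s
    overlapping c′ h = ≤-trans (length-⊆ (Unique.filter⁺ (_∈? vbl c′) (Unique.filter⁺ C? uU))
      (All.tabulate (λ v∈ → let v∈U , v∈c′ = ∈-filter⁻ (_∈? vbl c′) {xs = filter C? U} v∈ in
        ∈-filter⁺ (_∈? vbl c′) (proj₂ (∈-filter⁻ C? {xs = U} v∈U)) v∈c′))) h
    rearrange : ∀ a b ℓ s → a + (b + ℓ * ℓ * s + ℓ * s) ≡ (a + b) + (ℓ * ℓ * s + ℓ * s)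
    rearrange = solve-∀
    square : ∀ ℓ s → ℓ * ℓ * s + ℓ * s + suc ℓ * s ≡ suc ℓ * suc ℓ * s
    square = solve-∀

  Pinned : List (Fin n) → Assignment n → Clause n → Set
  Pinned W τ c = Any (λ l → proj₁ l ∈ W × Holds τ l) c

  pinned? : ∀ W τ → Decidable (Pinned W τ)
  pinned? W τ c = any? (λ l → (proj₁ l ∈? W) ×-dec holds? τ l) c

  pins : List (Fin n) → Assignment n → Clause n
  pins W τ = map (λ v → v , lookup τ v) W

  agrees? : ∀ W τ → Decidable (λ x → All (Holds x) (pins W τ))
  agrees? W τ x = all? (holds? x) (pins W τ)

  agrees-lookup : ∀ {W v} τ x → All (Holds x) (pins W τ) → v ∈ W → lookup x v ≡ lookup τ v
  agrees-lookup τ x ag v∈W = All.lookup ag (∈-map⁺ _ v∈W)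

  free? : ∀ W → Decidable (λ (l : Literal n) → proj₁ l ∉ W)
  free? W l = ¬? (proj₁ l ∈? W)

  residual : List (Fin n) → Clause n → Clause n
  residual W = filter (free? W)

  residual-vbl : ∀ {W c v} → v ∈ vbl (residual W c) → v ∈ vbl c × v ∉ W
  residual-vbl {W} {c} v∈ with ∈-map⁻ proj₁ v∈
  ... | l , l∈ , refl with ∈-filter⁻ (free? W) {xs = c} l∈
  ...   | l∈c , l∉W = ∈-map⁺ proj₁ l∈c , l∉W

  residual-unique : ∀ W {c} → Unique (vbl c) → Unique (vbl (residual W c))
  residual-unique W u = AllPairs.map⁺ (AllPairs.filter⁺ (free? W) (AllPairs.map⁻ u))

  -- Compare Φ with `Δ ++ F`, where `F` holds the clauses avoiding `W` and `Δ` the residuals of the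
  -- touched clauses that the pins do not satisfy. Dropping the touched clauses can only add
  -- solutions; putting back `Δ` costs at most a factor 2 for each of its at most |W| d clauses. As
  -- `Δ ++ F` ignores `W`, agreeing with τ costs exactly 2^|W|, and under that agreement `Δ ++ F`
  -- implies Φ.
  pinned-solutions :
    ∀ {k d w} (Φ : CNF n) W τ → Unique W → IsLocal k d w Φ →
    4 * (k * (d + d)) ≤ 2 ^ w → 4 ≤ 2 ^ w →
    (∀ {c} → c ∈ Φ → Pinned W τ c ⊎ w ≤ length (residual W c)) →
    #solutions Φ ≤ 2 ^ (length W * d + length W) * # (satisfies? Φ ∩? agrees? W τ) (assignments n)
  pinned-solutions {k} {d} {w} Φ W τ uW loc 8kd≤2^w 4≤2^w wide = begin
    #solutions Φ
      ≤⟨ #-mono (satisfies? Φ) (satisfies? F) (All.filter⁺ (∁? T?)) xs ⟩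
    #solutions F
      ≤⟨ #solutions-halving 4≤2^w Δ F loc′ ⟩
    2 ^ length Δ * #solutions (Δ ++ F)
      ≤⟨ *-monoˡ-≤ _ (^-monoʳ-≤ 2 Δ≤) ⟩
    2 ^ (length W * d) * #solutions (Δ ++ F)
      ≡⟨ cong (2 ^ (length W * d) *_) (#-literals (satisfies? (Δ ++ F)) (pins W τ)
           (subst Unique (sym vbl-pins) uW)
           (subst (All _) (sym vbl-pins) (untouched-ignores (Δ ++ F) untouched))) ⟨
    2 ^ (length W * d) * (# (satisfies? (Δ ++ F) ∩? agrees? W τ) xs * 2 ^ length (pins W τ))
      ≡⟨ cong (λ i → 2 ^ (length W * d) * (# (satisfies? (Δ ++ F) ∩? agrees? W τ) xs * 2 ^ i)) (length-map _ W) ⟩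
    2 ^ (length W * d) * (# (satisfies? (Δ ++ F) ∩? agrees? W τ) xs * 2 ^ length W)
      ≤⟨ *-monoʳ-≤ (2 ^ (length W * d)) (*-monoˡ-≤ (2 ^ length W)
           (#-mono (satisfies? (Δ ++ F) ∩? agrees? W τ) (satisfies? Φ ∩? agrees? W τ)
             (λ {x} (h , ag) → extend {x} h ag , ag) xs)) ⟩
    2 ^ (length W * d) * (M * 2 ^ length W)
      ≡⟨ rearrange (2 ^ (length W * d)) M (2 ^ length W) ⟩
    2 ^ (length W * d) * 2 ^ length W * M
      ≡⟨ cong (_* M) (^-distribˡ-+-* 2 (length W * d) (length W)) ⟨
    2 ^ (length W * d + length W) * M ∎
    where
    open ≤-Reasoning
    open LocalLemma {k = k} {d = d + d} {w = w} 8kd≤2^w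
    open IsLocal
    xs = assignments n
    M = # (satisfies? Φ ∩? agrees? W τ) xs
    T? = touches? W
    S? = T? ∩? ∁? (pinned? W τ)
    R = filter S? Φ
    F = filter (∁? T?) Φ
    Δ = map (residual W) R
    rearrange : ∀ a b c → a * (b * c) ≡ a * c * b
    rearrange = solve-∀
    vbl-pins : vbl (pins W τ) ≡ W
    vbl-pins = trans (sym (map-∘ W)) (map-id W)
    Δ≤ : length Δ ≤ length W * d
    Δ≤ = begin
      length Δ        ≡⟨ length-map (residual W) R ⟩
      # S? Φ          ≤⟨ #-mono S? T? proj₁ Φ ⟩
      # T? Φ          ≤⟨ #-touching W Φ (loc .degree-bound) ⟩
      length W * d    ∎
    wide-residual : ∀ {c} → c ∈ R → w ≤ length (residual W c)
    wide-residual c∈ with ∈-filter⁻ S? {xs = Φ} c∈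
    ... | c∈Φ , _ , ¬pin with wide c∈Φ
    ...   | inj₁ pin = ⊥-elim (¬pin pin)
    ...   | inj₂ w≤  = w≤
    residual-width : ∀ {c} → c ∈ R → length (residual W c) ≤ k × w ≤ length (residual W c) × Unique (vbl (residual W c))
    residual-width {c} c∈ with All.lookup (All.filter⁺ S? (loc .width)) c∈
    ... | c≤k , _ , uc = ≤-trans (length-filter (free? W) c) c≤k , wide-residual c∈ , residual-unique W uc
    loc′ : IsLocal k (d + d) w (Δ ++ F)
    loc′ .width = All.++⁺ (All.map⁺ (All.tabulate residual-width)) (All.filter⁺ (∁? T?) (loc .width))
    -- The parts `Δ` and `F` are bounded separately, which is why the local lemma is applied with
    -- degree `d + d`.
    loc′ .degree-bound v = begin
      degree (Δ ++ F) v         ≡⟨ #-++ (λ c → v ∈? vbl c) Δ F ⟩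
      degree Δ v + degree F v   ≤⟨ +-mono-≤ degreeΔ (≤-trans (#-filter-≤ (λ c → v ∈? vbl c) (∁? T?) Φ) (loc .degree-bound v)) ⟩
      d + d                     ∎
      where
      degreeΔ : degree Δ v ≤ d
      degreeΔ = begin
        degree Δ v                                ≡⟨ #-map (λ c → v ∈? vbl c) (residual W) R ⟩
        # (λ c → v ∈? vbl (residual W c)) R       ≤⟨ #-mono (λ c → v ∈? vbl (residual W c)) (λ c → v ∈? vbl c)
                                                       (λ {c} v∈ → proj₁ (residual-vbl {W} {c} v∈)) R ⟩
        degree R v                                ≤⟨ #-filter-≤ (λ c → v ∈? vbl c) S? Φ ⟩
        degree Φ v                                ≤⟨ loc .degree-bound v ⟩
        d                                         ∎
    untouched : All (λ c → ¬ Touches W c) (Δ ++ F)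
    untouched = All.++⁺
      (All.map⁺ (All.tabulate {xs = R} λ {c} _ t → let v , v∈W , v∈c = find t in proj₂ (residual-vbl {W} {c} v∈c) v∈W))
      (All.all-filter (∁? T?) Φ)
    extend : ∀ {x} → Satisfies (Δ ++ F) x → All (Holds x) (pins W τ) → Satisfies Φ x
    extend {x} h ag = All.tabulate sat
      where
      sat : ∀ {c} → c ∈ Φ → Any (Holds x) c
      sat {c} c∈Φ with T? c
      ... | no ¬t = All.lookup (All.++⁻ʳ Δ h) (∈-filter⁺ (∁? T?) c∈Φ ¬t)
      ... | yes t with pinned? W τ c
      ...   | yes pin = Any.map (λ (v∈W , hτ) → trans (agrees-lookup τ x ag v∈W) hτ) pin
      ...   | no ¬pin = Any.filter⁻ (free? W)
                          (All.lookup (All.map⁻ (All.++⁻ˡ Δ h)) (∈-filter⁺ S? c∈Φ (t , ¬pin)))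

-- Clauses overlapping a violated candidate

module _ {n : ℕ} where
  open DecMembership (Fin._≟_ {n}) using (_∈?_)
  open IsKDS-CNF
  open IsLocal

  kclause-unique : ∀ {k} {c : Clause n} → IsKClause k c → Unique (vbl c)
  kclause-unique (_ , sorted) = AllPairs.map (λ u<v → Fin.<⇒≢ u<v) sorted

  kds-local : ∀ {k d s} {Φ : CNF n} → IsKDS-CNF k d s Φ → ∀ {w} → w ≤ k → IsLocal k d w Φ
  kds-local kds w≤k .width = All.map
    (λ kc → ≤-reflexive (proj₁ kc) , ≤-trans w≤k (≤-reflexive (sym (proj₁ kc))) , kclause-unique kc) (kds .width)
  kds-local kds w≤k .degree-bound = kds .degree-bound

  witnesses : ∀ (τ : Assignment n) Ψ → Satisfies Ψ τ →
              ∃ λ vs → length vs ≡ length Ψ × All (Pinned vs τ) Ψ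
  witnesses τ []      []       = [] , refl , []
  witnesses τ (c ∷ Ψ) (h ∷ hs) with find h | witnesses τ Ψ hs
  ... | (v , b) , l∈c , hl | vs , len , ps =
    v ∷ vs , cong suc len , lose l∈c (here refl , hl) ∷ All.map (Any.map (λ (u∈ , hτ) → there u∈ , hτ)) ps

  violates-pins : ∀ {W} {τ x : Assignment n} c → (∀ {v} → v ∈ vbl c → v ∈ W) → ¬ Any (Holds τ) c →
                  All (Holds x) (pins W τ) → ¬ Any (Holds x) c
  violates-pins {W} {τ} {x} c c⊆W ¬h ag h = let (v , b) , l∈c , hx = find h in
    ¬h (lose l∈c (trans (sym (agrees-lookup τ x ag (c⊆W (∈-map⁺ proj₁ l∈c)))) hx))

  -- m clauses meeting U in more than m s + q variables, pairwise sharing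
  -- at most s, would cover more than m q + m > |U| variables of U.
  few-overlapping : ∀ {s m q} (U : List (Fin n)) Ψ → Unique U → AllPairs (λ c c′ → shared c c′ ≤ s) Ψ →
                    All (λ c → suc (m * s + q) ≤ # (_∈? vbl c) U) Ψ → length U < m + m * q → length Ψ ≤ m
  few-overlapping {s} {m} {q} U Ψ uU sh big U< with m ≤? length Ψ
  ... | no m≰ = <⇒≤ (≰⇒> m≰)
  ... | yes m≤ = ⊥-elim (<-irrefl refl (begin-strict
    m * suc (m * s + q)                          ≡⟨ cong (_* suc (m * s + q)) len ⟨
    length Θ * suc (m * s + q)                   ≤⟨ sum-map-≥ _ Θ (All.take⁺ m big) ⟩
    sum (map (λ c → # (_∈? vbl c) U) Θ)          ≤⟨ bonferroni U Θ uU (AllPairs.take⁺ m sh) ⟩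
    length U + length Θ * length Θ * s           ≡⟨ cong (λ i → length U + i * i * s) len ⟩
    length U + m * m * s                         <⟨ +-monoˡ-< (m * m * s) U< ⟩
    m + m * q + m * m * s                        ≡⟨ rearrange m s q ⟩
    m * suc (m * s + q)                          ∎))
    where
    open ≤-Reasoning
    -- Exactly `m` clauses are kept, since the quadratic error term of `bonferroni` grows with their
    -- number.
    Θ = take m Ψ
    len : length Θ ≡ m
    len = trans (length-take m Ψ) (m≤n⇒m⊓n≡m m≤)
    rearrange : ∀ m s q → m + m * q + m * m * s ≡ m * suc (m * s + q)
    rearrange = solve-∀

  -- The at most m clauses that are almost contained in c are satisfied by
  -- pinning one further variable of each to its value in τ; all the other
  -- residual clauses are then long enough for the local lemma.
  violation-likely :
    ∀ {k d s m q} {Φ : CNF n} {c τ} → IsKDS-CNF k d s Φ → IsKClause k c →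
    k < m + m * q → m * s ≤ q → m ≤ q →
    4 * (k * (d + d)) ≤ 2 ^ (k ∸ 3 * q) → 4 ≤ 2 ^ (k ∸ 3 * q) →
    Satisfies Φ τ → ¬ Any (Holds τ) c →
    #solutions Φ ≤ 2 ^ ((k + m) * d + (k + m)) * # (satisfies? Φ ∩? violated? c) (assignments n)
  violation-likely {k} {d} {s} {m} {q} {Φ} {c} {τ} kds kc k< ms≤q m≤q 8kd≤ 4≤ sat ¬h = begin
    #solutions Φ
      ≤⟨ pinned-solutions Φ W τ uW (kds-local kds (m∸n≤m k (3 * q))) 8kd≤ 4≤ pinned-or-wide ⟩
    2 ^ (length W * d + length W) * # (satisfies? Φ ∩? agrees? W τ) (assignments n)
      ≤⟨ *-mono-≤ (^-monoʳ-≤ 2 (+-mono-≤ (*-monoˡ-≤ d W≤) W≤))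
           (#-mono (satisfies? Φ ∩? agrees? W τ) (satisfies? Φ ∩? violated? c)
             (λ {x} (hs , ag) → hs , violates-pins {τ = τ} {x = x} c (λ v∈ → ∈-deduplicate⁺ Fin._≟_ (∈-++⁺ˡ v∈)) ¬h ag) (assignments n)) ⟩
    2 ^ ((k + m) * d + (k + m)) * # (satisfies? Φ ∩? violated? c) (assignments n) ∎
    where
    open ≤-Reasoning
    U = vbl c
    uU : Unique U
    uU = kclause-unique kc
    U≡k : length U ≡ k
    U≡k = trans (length-map proj₁ c) (proj₁ kc)
    heavy? : Decidable (λ c′ → suc (m * s + q) ≤ # (_∈? vbl c′) U)
    heavy? c′ = suc (m * s + q) ≤? # (_∈? vbl c′) U
    H = filter heavy? Φ
    H≤m : length H ≤ m
    H≤m = few-overlapping {s} U H uU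
      (AllPairs.filter⁺ heavy? (unique-AllPairs Φ (kds .unique) (kds .overlap-bound)))
      (All.all-filter heavy? Φ) (≤-trans (s≤s (≤-reflexive U≡k)) k<)
    pick = witnesses τ H (All.filter⁺ heavy? sat)
    vs = proj₁ pick
    vs≤m : length vs ≤ m
    vs≤m = ≤-trans (≤-reflexive (proj₁ (proj₂ pick))) H≤m
    -- The extra variables may repeat or lie in `c`, whereas counting agreements needs distinct
    -- variables.
    W = deduplicate Fin._≟_ (U ++ vs)
    uW : Unique W
    uW = DecUnique.deduplicate-! Fin._≟_ (U ++ vs)
    W≤ : length W ≤ k + m
    W≤ = begin
      length W             ≤⟨ length-deduplicate Fin._≟_ (U ++ vs) ⟩
      length (U ++ vs)     ≡⟨ length-++ U ⟩
      length U + length vs ≤⟨ +-mono-≤ (≤-reflexive U≡k) vs≤m ⟩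
      k + m                ∎
    in-W : ∀ {v} → v ∈ vs → v ∈ W
    in-W v∈ = ∈-deduplicate⁺ Fin._≟_ (∈-++⁺ʳ U v∈)
    pinned-or-wide : ∀ {c′} → c′ ∈ Φ → Pinned W τ c′ ⊎ k ∸ 3 * q ≤ length (residual W c′)
    pinned-or-wide {c′} c′∈ with heavy? c′
    ... | yes h = inj₁ (Any.map (λ (v∈ , hτ) → in-W v∈ , hτ)
                    (All.lookup (proj₂ (proj₂ pick)) (∈-filter⁺ heavy? c′∈ h)))
    ... | no ¬h = inj₂ (m≤n+o⇒m∸n≤o k (3 * q) (begin
      k                                               ≡⟨ proj₁ kc′ ⟨
      length c′                                       ≡⟨ #-complement (λ l → proj₁ l ∈? W) c′ ⟨
      # (λ l → proj₁ l ∈? W) c′ + length (residual W c′)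
        ≡⟨ cong (_+ length (residual W c′)) (#-map (_∈? W) proj₁ c′) ⟨
      # (_∈? W) (vbl c′) + length (residual W c′)     ≤⟨ +-monoˡ-≤ _ covered ⟩
      3 * q + length (residual W c′)                  ∎))
      where
      kc′ : IsKClause k c′
      kc′ = All.lookup (kds .width) c′∈
      light : ∀ {v} → v ∈ W → ¬ v ∈ U → v ∈ vs
      light v∈ v∉ with ∈-++⁻ U (∈-deduplicate⁻ Fin._≟_ (U ++ vs) v∈)
      ... | inj₁ v∈U  = ⊥-elim (v∉ v∈U)
      ... | inj₂ v∈vs = v∈vs
      triple : ∀ q → q + q + q ≡ 3 * q
      triple = solve-∀
      -- A light clause loses at most `m * s + q` variables to `c` and at most `m` to the extra
      -- pins; each of the three terms is at most `q`.
      covered : # (_∈? W) (vbl c′) ≤ 3 * q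
      covered = begin
        # (_∈? W) (vbl c′)
          ≤⟨ #-union (_∈? W) (_∈? U) (_∈? vs) light (vbl c′) ⟩
        # (_∈? U) (vbl c′) + # (_∈? vs) (vbl c′)
          ≤⟨ +-mono-≤ (≤-trans (shared-comm-≤ U (kclause-unique kc′)) (s≤s⁻¹ (≰⇒> ¬h)))
                      (≤-trans (#-∈-≤ vs (kclause-unique kc′)) vs≤m) ⟩
        m * s + q + m
          ≤⟨ +-mono-≤ (+-monoˡ-≤ q ms≤q) m≤q ⟩
        q + q + q
          ≡⟨ triple q ⟩
        3 * q ∎

-- The algorithm on samples

∈-tuples : ∀ {A : Set} {T} {xs : List A} {X : Vec A T} → VecAll.All (_∈ xs) X → X ∈ tuples T xs
∈-tuples []       = here refl
∈-tuples (x∈ ∷ X∈) = ∈-cartesianProductWith⁺ _∷_ x∈ (∈-tuples X∈)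

∈-assignments : ∀ {n} (x : Assignment n) → x ∈ assignments n
∈-assignments x = ∈-tuples (VecAll.universal (λ { true → here refl ; false → there (here refl) }) x)

#-cartesianProductWith : ∀ {A : Set} {T} {P : Pred A 0ℓ} (P? : Decidable P) (xs : List A) (Ys : List (Vec A T)) →
  # (VecAll.all? P?) (cartesianProductWith _∷_ xs Ys) ≡ # P? xs * # (VecAll.all? P?) Ys
#-cartesianProductWith P? [] Ys = refl
#-cartesianProductWith {P = P} P? (x ∷ xs) Ys = begin
  # all (map (x ∷_) Ys ++ cartesianProductWith _∷_ xs Ys)
    ≡⟨ #-++ all (map (x ∷_) Ys) _ ⟩
  # all (map (x ∷_) Ys) + # all (cartesianProductWith _∷_ xs Ys)
    ≡⟨ cong₂ _+_ (#-map all (x ∷_) Ys) (#-cartesianProductWith P? xs Ys) ⟩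
  # (all ∘ (x ∷_)) Ys + # P? xs * # all Ys
    ≡⟨ first (P? x) ⟩
  # P? (x ∷ xs) * # all Ys ∎
  where
  open ≡-Reasoning
  all : ∀ {T} → Decidable (VecAll.All _)
  all {T} = VecAll.all? {n = T} P?
  first : Dec (P x) → # (all ∘ (x ∷_)) Ys + # P? xs * # all Ys ≡ # P? (x ∷ xs) * # all Ys
  first (yes p) = trans
    (cong (_+ # P? xs * # all Ys) (#-cong (all ∘ (x ∷_)) all (λ { (_ ∷ ps) → ps }) (λ ps → p ∷ ps) Ys))
    (cong (λ zs → length zs * # all Ys) (sym (filter-accept P? p)))
  first (no ¬p) = trans
    (cong (_+ # P? xs * # all Ys) (#-none (all ∘ (x ∷_)) (λ { _ (p ∷ _) → ¬p p }) Ys))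
    (cong (λ zs → length zs * # all Ys) (sym (filter-reject P? ¬p)))

#-tuples : ∀ {A : Set} {P : Pred A 0ℓ} (P? : Decidable P) T (xs : List A) →
           # (VecAll.all? P?) (tuples T xs) ≡ # P? xs ^ T
#-tuples P? zero    xs = refl
#-tuples P? (suc T) xs = trans (#-cartesianProductWith P? xs (tuples T xs)) (cong (# P? xs *_) (#-tuples P? T xs))

-- Bernoulli's inequality (1 + V/S)^j ≥ 1 + jV/S cleared of denominators, which makes it valid for S
-- = 0 too.
bernoulli : ∀ S V j → S ^ j * (S + j * V) ≤ (S + V) ^ j * S
bernoulli S V zero    = ≤-reflexive (rearrange S V)
  where
  rearrange : ∀ S V → 1 * (S + 0 * V) ≡ 1 * S
  rearrange = solve-∀
bernoulli S V (suc j) = begin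
  S * P * (S + suc j * V)                        ≤⟨ m≤m+n _ (P * (j * (V * V))) ⟩
  S * P * (S + suc j * V) + P * (j * (V * V))    ≡⟨ rearrange S V j P ⟩
  (S + V) * (P * (S + j * V))                    ≤⟨ *-monoʳ-≤ (S + V) (bernoulli S V j) ⟩
  (S + V) * ((S + V) ^ j * S)                    ≡⟨ *-assoc (S + V) ((S + V) ^ j) S ⟨
  (S + V) * (S + V) ^ j * S                      ∎
  where
  open ≤-Reasoning
  P = S ^ j
  rearrange : ∀ S V j P → S * P * (S + suc j * V) + P * (j * (V * V)) ≡ (S + V) * (P * (S + j * V))
  rearrange = solve-∀

-- If violating solutions number at least S / y, then by Bernoulli (1 + V/S)^y ≥ 2: a block of `y`
-- samples halves the chance that the clause survives.
amplify : ∀ S V y .{{_ : NonZero y}} → S ≤ y * V → 2 * S ^ y ≤ (S + V) ^ y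
amplify zero V (suc y) h = z≤n
amplify S@(suc _) V y h = *-cancelʳ-≤ _ _ S (begin
  2 * S ^ y * S            ≡⟨ rearrange (S ^ y) S ⟩
  S ^ y * (S + S)          ≤⟨ *-monoʳ-≤ (S ^ y) (+-monoʳ-≤ S h) ⟩
  S ^ y * (S + y * V)      ≤⟨ bernoulli S V y ⟩
  (S + V) ^ y * S          ∎)
  where
  open ≤-Reasoning
  rearrange : ∀ P S → 2 * P * S ≡ P * (S + S)
  rearrange = solve-∀

^-distribʳ-* : ∀ k m n → (m * n) ^ k ≡ m ^ k * n ^ k
^-distribʳ-* zero    m n = refl
^-distribʳ-* (suc k) m n = trans (cong (m * n *_) (^-distribʳ-* k m n)) (rearrange m n (m ^ k) (n ^ k))
  where
  rearrange : ∀ a b c d → a * b * (c * d) ≡ a * c * (b * d)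
  rearrange = solve-∀

μ-cong : ∀ {n} (Φ Ψ : CNF n) → (∀ x → Satisfies Φ x → Satisfies Ψ x) →
         (∀ x → Satisfies Ψ x → Satisfies Φ x) → ∀ x → μ Φ x ≡ μ Ψ x
μ-cong {n} Φ Ψ f g x with satisfies? Φ x | satisfies? Ψ x
... | yes _ | yes _ = cong reciprocal (#-cong (satisfies? Φ) (satisfies? Ψ) (λ {x} → f x) (λ {x} → g x) (assignments n))
... | yes p | no ¬q = ⊥-elim (¬q (f x p))
... | no ¬p | yes q = ⊥-elim (¬p (g x q))
... | no _  | no _  = refl

-- The output of the algorithm and its failures

module _ {n : ℕ} where

  prepend-value : ∀ (l : Literal n) cs ds → value (prepend l cs ds) ≡ map (l ∷_) cs ++ ds
  prepend-value l []       ds = refl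
  prepend-value l (c ∷ cs) ds = cong ((l ∷ c) ∷_) (prepend-value l cs ds)

  candidates-value : ∀ k (v : Fin n) vs →
    value (candidates (suc k) (v ∷ vs)) ≡
    map ((v , true) ∷_) (value (candidates k vs)) ++
      (map ((v , false) ∷_) (value (candidates k vs)) ++ value (candidates (suc k) vs))
  candidates-value k v vs = trans
    (prepend-value (v , true) (value (candidates k vs)) _)
    (cong (map ((v , true) ∷_) (value (candidates k vs)) ++_) (prepend-value (v , false) (value (candidates k vs)) _))

  kclause-∷ : ∀ {k v b} {vs : List (Fin n)} {c} → All (v Fin.<_) vs → IsKClause k c × All (_∈ vs) (vbl c) →
              IsKClause (suc k) ((v , b) ∷ c) × All (_∈ v ∷ vs) (v ∷ vbl c)
  kclause-∷ v< ((len , c<) , c⊆) =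
    (cong suc len , All.map (All.lookup v<) c⊆ ∷ c<) , here refl ∷ All.map there c⊆

  candidates-sound : ∀ k {vs : List (Fin n)} {c} → AllPairs Fin._<_ vs → c ∈ value (candidates k vs) →
                     IsKClause k c × All (_∈ vs) (vbl c)
  candidates-sound zero    vs< (here refl) = (refl , []) , []
  candidates-sound (suc k) {v ∷ vs} (v< ∷ vs<) c∈
    with ∈-++⁻ (map ((v , true) ∷_) (value (candidates k vs))) (subst (_ ∈_) (candidates-value k v vs) c∈)
  ... | inj₁ c∈t with ∈-map⁻ _ c∈t
  ...   | c′ , c′∈ , refl = kclause-∷ {b = true} v< (candidates-sound k vs< c′∈)
  candidates-sound (suc k) {v ∷ vs} (v< ∷ vs<) c∈ | inj₂ c∈fr
    with ∈-++⁻ (map ((v , false) ∷_) (value (candidates k vs))) c∈fr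
  ... | inj₂ c∈r = let kc , c⊆ = candidates-sound (suc k) vs< c∈r in kc , All.map there c⊆
  ... | inj₁ c∈f with ∈-map⁻ _ c∈f
  ...   | c′ , c′∈ , refl = kclause-∷ {b = false} v< (candidates-sound k vs< c′∈)

  above : ∀ {v : Fin n} {us vs} → All (v Fin.<_) us → All (_∈ v ∷ vs) us → All (_∈ vs) us
  above []         []              = []
  above (v<u ∷ h)  (here refl ∷ ∈) = ⊥-elim (Fin.<-irrefl refl v<u)
  above (v<u ∷ h)  (there u∈ ∷ ∈)  = u∈ ∷ above h ∈

  -- The variables of a clause are sorted, so `v` can occur only at its head; if it does not, the
  -- whole clause lives on `vs`.
  candidates-complete : ∀ k {vs : List (Fin n)} {c} → AllPairs Fin._<_ vs → IsKClause k c → All (_∈ vs) (vbl c) →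
                        c ∈ value (candidates k vs)
  candidates-complete zero    {c = []} vs< _ _ = here refl
  candidates-complete (suc k) {v ∷ vs} {(u , b) ∷ c} (v< ∷ vs<) (len , u< ∷ c<) (u∈ ∷ c⊆) =
    subst (_ ∈_) (sym (candidates-value k v vs)) (place u∈ b)
    where
    cs = value (candidates k vs)
    place : u ∈ v ∷ vs → ∀ b → ((u , b) ∷ c) ∈ map ((v , true) ∷_) cs ++ (map ((v , false) ∷_) cs ++ value (candidates (suc k) vs))
    place (here refl) true  = ∈-++⁺ˡ (∈-map⁺ _ (candidates-complete k vs< (suc-injective len , c<) (above u< c⊆)))
    place (here refl) false = ∈-++⁺ʳ (map ((v , true) ∷_) cs) (∈-++⁺ˡ (∈-map⁺ _ (candidates-complete k vs< (suc-injective len , c<) (above u< c⊆))))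
    place (there u∈vs) b = ∈-++⁺ʳ (map ((v , true) ∷_) cs) (∈-++⁺ʳ (map ((v , false) ∷_) cs)
      (candidates-complete (suc k) vs< (len , u< ∷ c<)
        (u∈vs ∷ above (All.map (Fin.<-trans (All.lookup v< u∈vs)) u<) c⊆)))

  violates-value : ∀ (x : Assignment n) c → value (violates x c) ≡ does (violated? c x)
  violates-value x []      = refl
  violates-value x (l ∷ c) with holds? x l
  ... | yes _ = refl
  ... | no _  = violates-value x c

  removeViolated-value : ∀ (x : Assignment n) cs → value (removeViolated x cs) ≡ filter (λ c → clause? c x) cs
  removeViolated-value x []       = refl
  removeViolated-value x (c ∷ cs) rewrite violates-value x c with clause? c x
  ... | yes _ = cong (c ∷_) (removeViolated-value x cs)
  ... | no _  = removeViolated-value x cs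

  removeAll-sound : ∀ {T} (X : Vec (Assignment n) T) {cs c} → c ∈ value (removeAll X cs) →
                    c ∈ cs × VecAll.All (λ x → Any (Holds x) c) X
  removeAll-sound []      c∈ = c∈ , []
  removeAll-sound (x ∷ X) {cs} c∈ with removeAll-sound X c∈
  ... | c∈′ , hs with ∈-filter⁻ (λ c → clause? c x) {xs = cs} (subst (_ ∈_) (removeViolated-value x cs) c∈′)
  ...   | c∈cs , h = c∈cs , h ∷ hs

  removeAll-complete : ∀ {T} (X : Vec (Assignment n) T) {cs c} → c ∈ cs → VecAll.All (λ x → Any (Holds x) c) X →
                       c ∈ value (removeAll X cs)
  removeAll-complete []      c∈ []       = c∈
  removeAll-complete (x ∷ X) {cs} c∈ (h ∷ hs) = removeAll-complete X
    (subst (_ ∈_) (sym (removeViolated-value x cs)) (∈-filter⁺ (λ c → clause? c x) c∈ h)) hs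

  allFin-< : AllPairs Fin._<_ (allFin n)
  allFin-< = AllPairs.tabulate⁺-< id

  allClauses : ℕ → CNF n
  allClauses k = value (candidates k (allFin n))

  module _ {k : ℕ} (Φ : CNF n) where

    -- These are the clauses not implied by Φ. Searching the finite list `assignments` makes this
    -- decidable and yields the τ to which the variables get pinned.
    Refutable : Clause n → Set
    Refutable c = Any (λ x → Satisfies Φ x × ¬ Any (Holds x) c) (assignments n)

    refutable? : Decidable Refutable
    refutable? c = any? (satisfies? Φ ∩? violated? c) (assignments n)

    -- Samples that satisfy Φ never delete a clause of Φ, so the output implies Φ. Conversely, when
    -- no refutable clause is left, every clause of the output is implied by Φ.
    learns-when : ∀ {T} (X : Vec (Assignment n) T) → All (IsKClause k) Φ → VecAll.All (Satisfies Φ) X →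
                  All (λ c → ¬ VecAll.All (λ x → Any (Holds x) c) X) (filter refutable? (allClauses k)) →
                  Learns k Φ X
    learns-when X width sat noneLeft = All.universal (μ-cong Φ̂ Φ weaken strengthen) (assignments n)
      where
      Φ̂ = value (valiant k X)
      weaken : ∀ x → Satisfies Φ̂ x → Satisfies Φ x
      weaken x hs = All.tabulate (λ {c} c∈Φ → All.lookup hs (removeAll-complete X
        (candidates-complete k allFin-< (All.lookup width c∈Φ) (All.universal ∈-allFin (vbl c)))
        (VecAll.map (λ h → All.lookup h c∈Φ) sat)))
      strengthen : ∀ x → Satisfies Φ x → Satisfies Φ̂ x
      strengthen x hs = All.tabulate (λ {c} c∈Φ̂ → decidable-stable (clause? c x) (λ ¬h →
        let c∈ , all = removeAll-sound X {allClauses k} c∈Φ̂ in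
        All.lookup noneLeft (∈-filter⁺ refutable? c∈ (lose (∈-assignments x) (hs , ¬h))) all))

    -- The `T` samples form `a + b` blocks of `y`, so a refutable clause survives with probability
    -- at most 2^-(a+b). The union bound over at most 2^a candidates leaves 2^-b.
    #-failures :
      ∀ {y a b} .{{_ : NonZero y}} → All (IsKClause k) Φ → length (allClauses k) ≤ 2 ^ a →
      (∀ {c τ} → IsKClause k c → Satisfies Φ τ → ¬ Any (Holds τ) c →
         #solutions Φ ≤ y * # (satisfies? Φ ∩? violated? c) (assignments n)) →
      let T = y * (a + b) in
      # (VecAll.all? (satisfies? Φ) ∩? ∁? (learns? {T = T} k Φ)) (tuples T (assignments n)) * 2 ^ b ≤
      #solutions Φ ^ T
    #-failures {y} {a} {b} width len likely = *-cancelʳ-≤ _ _ (2 ^ a) {{m^n≢0 2 a}} (begin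
      # F? Xs * 2 ^ b * 2 ^ a
        ≡⟨ rearrange (# F? Xs) (2 ^ b) (2 ^ a) ⟩
      2 ^ a * 2 ^ b * # F? Xs
        ≡⟨ cong (_* # F? Xs) (^-distribˡ-+-* 2 a b) ⟨
      2 ^ R * # F? Xs
        ≤⟨ *-monoʳ-≤ (2 ^ R) (#-any F? kept? Rs missed Xs) ⟩
      2 ^ R * sum (map (λ c → # (kept? c) Xs) Rs)
        ≤⟨ scaled Rs (All.tabulate each) ⟩
      length Rs * N ^ T
        ≤⟨ *-monoˡ-≤ (N ^ T) (≤-trans (length-filter refutable? (allClauses k)) len) ⟩
      2 ^ a * N ^ T
        ≡⟨ *-comm (2 ^ a) _ ⟩
      N ^ T * 2 ^ a ∎)
      where
      open ≤-Reasoning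
      R = a + b
      T = y * R
      N = #solutions Φ
      Xs = tuples T (assignments n)
      F? = VecAll.all? (satisfies? Φ) ∩? ∁? (learns? {T = T} k Φ)
      Rs = filter refutable? (allClauses k)
      kept? : ∀ c → Decidable (VecAll.All (Satisfies Φ ∩ (λ x → Any (Holds x) c)) {T})
      kept? c = VecAll.all? (satisfies? Φ ∩? clause? c)
      rearrange : ∀ a b c → a * b * c ≡ c * b * a
      rearrange = solve-∀
      missed : ∀ {X} → VecAll.All (Satisfies Φ) X × ¬ Learns k Φ X →
               Any (λ c → VecAll.All (Satisfies Φ ∩ (λ x → Any (Holds x) c)) X) Rs
      missed {X} (sat , fail) with any? (λ c → kept? c X) Rs
      ... | yes h = h
      ... | no ¬h = ⊥-elim (fail (learns-when X width sat
              (All.map (λ ¬k h → ¬k (VecAll.zip (sat , h))) (All.¬Any⇒All¬ Rs ¬h))))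
      each : ∀ {c} → c ∈ Rs → 2 ^ R * # (kept? c) Xs ≤ N ^ T
      each {c} c∈ with ∈-filter⁻ refutable? {xs = allClauses k} c∈
      ... | c∈cs , ref with find ref
      ...   | τ , _ , sat , ¬h = begin
        2 ^ R * # (kept? c) Xs        ≡⟨ cong (2 ^ R *_) (#-tuples (satisfies? Φ ∩? clause? c) T (assignments n)) ⟩
        2 ^ R * S ^ (y * R)           ≡⟨ cong (2 ^ R *_) (^-*-assoc S y R) ⟨
        2 ^ R * (S ^ y) ^ R           ≡⟨ ^-distribʳ-* R 2 (S ^ y) ⟨
        (2 * S ^ y) ^ R               ≤⟨ ^-monoˡ-≤ R (amplify S V y S≤yV) ⟩
        ((S + V) ^ y) ^ R             ≡⟨ ^-*-assoc (S + V) y R ⟩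
        (S + V) ^ T                   ≡⟨ cong (_^ T) N≡S+V ⟨
        N ^ T                         ∎
        where
        S = # (satisfies? Φ ∩? clause? c) (assignments n)
        V = # (satisfies? Φ ∩? violated? c) (assignments n)
        N≡S+V : N ≡ S + V
        N≡S+V = #-split (satisfies? Φ) (clause? c) (assignments n)
        S≤yV : S ≤ y * V
        S≤yV = begin
          S       ≤⟨ m≤m+n S V ⟩
          S + V   ≡⟨ N≡S+V ⟨
          N       ≤⟨ likely {τ = τ} (proj₁ (candidates-sound k allFin-< c∈cs)) sat ¬h ⟩
          y * V   ∎
      scaled : ∀ cs → All (λ c → 2 ^ R * # (kept? c) Xs ≤ N ^ T) cs →
               2 ^ R * sum (map (λ c → # (kept? c) Xs) cs) ≤ length cs * N ^ T
      scaled []       []       = ≤-reflexive (*-zeroʳ (2 ^ R))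
      scaled (c ∷ cs) (h ∷ hs) = ≤-trans (≤-reflexive (*-distribˡ-+ (2 ^ R) (# (kept? c) Xs) _))
                                         (+-mono-≤ h (scaled cs hs))

-- Probabilities

/-mono-< : ∀ {a b c d} .{{_ : NonZero b}} .{{_ : NonZero d}} → a * d < c * b → pos a / b ℚ.< pos c / d
/-mono-< {a} {suc b} {c} {suc d} h = ℚ.toℚᵘ-cancel-< (begin-strict
  toℚᵘ (pos a / suc b)  ≃⟨ ℚ.toℚᵘ-fromℚᵘ (mkℚᵘ (pos a) b) ⟩
  mkℚᵘ (pos a) b        <⟨ *<* (subst₂ ℤ._<_ (ℤ.pos-* a (suc d)) (ℤ.pos-* c (suc b)) (ℤ.+<+ h)) ⟩
  mkℚᵘ (pos c) d        ≃⟨ ℚ.toℚᵘ-fromℚᵘ (mkℚᵘ (pos c) d) ⟨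
  toℚᵘ (pos c / suc d)  ∎)
  where open ℚᵘ.≤-Reasoning

/-cancel-< : ∀ {a b c d} .{{_ : NonZero b}} .{{_ : NonZero d}} → pos a / b ℚ.< pos c / d → a * d < c * b
/-cancel-< {a} {suc b} {c} {suc d} h with mkℚᵘ<mkℚᵘ
  where
  open ℚᵘ.≤-Reasoning
  mkℚᵘ<mkℚᵘ : mkℚᵘ (pos a) b ℚᵘ.< mkℚᵘ (pos c) d
  mkℚᵘ<mkℚᵘ = begin-strict
    mkℚᵘ (pos a) b        ≃⟨ ℚ.toℚᵘ-fromℚᵘ (mkℚᵘ (pos a) b) ⟨
    toℚᵘ (pos a / suc b)  <⟨ ℚ.toℚᵘ-mono-< h ⟩
    toℚᵘ (pos c / suc d)  ≃⟨ ℚ.toℚᵘ-fromℚᵘ (mkℚᵘ (pos c) d) ⟩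
    mkℚᵘ (pos c) d        ∎
... | *<* lt = ℤ.drop‿+<+ (subst₂ ℤ._<_ (sym (ℤ.pos-* a (suc d))) (sym (ℤ.pos-* c (suc b))) lt)

-- Turns the condition on η at the exponent p / (p + 1) into a comparison of η with 1 / (p + 1).
1-p/[1+p] : ∀ p → 1ℚ ℚ.- pos p / suc p ≡ pos 1 / suc p
1-p/[1+p] p = ℚ.toℚᵘ-injective (begin
  toℚᵘ (1ℚ ℚ.- pos p / suc p)                     ≈⟨ ℚ.toℚᵘ-homo-+ 1ℚ (ℚ.- (pos p / suc p)) ⟩
  toℚᵘ 1ℚ ℚᵘ.+ toℚᵘ (ℚ.- (pos p / suc p))         ≈⟨ ℚᵘ.+-congʳ (toℚᵘ 1ℚ) (ℚ.toℚᵘ-homo‿- (pos p / suc p)) ⟩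
  toℚᵘ 1ℚ ℚᵘ.- toℚᵘ (pos p / suc p)               ≈⟨ ℚᵘ.+-congʳ (toℚᵘ 1ℚ) (ℚᵘ.-‿cong (ℚ.toℚᵘ-fromℚᵘ (mkℚᵘ (pos p) p))) ⟩
  toℚᵘ 1ℚ ℚᵘ.- mkℚᵘ (pos p) p                     ≈⟨ *≡* (trans (integers (pos p)) (cong (λ i → pos 1 ℤ.* pos (suc i)) (sym (+-identityʳ p)))) ⟩
  mkℚᵘ (pos 1) p                                  ≈⟨ ℚ.toℚᵘ-fromℚᵘ (mkℚᵘ (pos 1) p) ⟨
  toℚᵘ (pos 1 / suc p)                            ∎)
  where
  open ℚᵘ.≃-Reasoning
  integers : ∀ i → (pos 1 ℤ.* (pos 1 ℤ.+ i) ℤ.+ (ℤ.- i) ℤ.* pos 1) ℤ.* (pos 1 ℤ.+ i) ≡ pos 1 ℤ.* (pos 1 ℤ.+ i)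
  integers = ℤSolver.solve-∀

fromℕ : ℕ → ℚ
fromℕ zero    = 0ℚ
fromℕ (suc n) = 1ℚ ℚ.+ fromℕ n

fromℕ-+ : ∀ m n → fromℕ (m + n) ≡ fromℕ m ℚ.+ fromℕ n
fromℕ-+ zero    n = sym (ℚ.+-identityˡ _)
fromℕ-+ (suc m) n = trans (cong (1ℚ ℚ.+_) (fromℕ-+ m n)) (sym (ℚ.+-assoc 1ℚ (fromℕ m) (fromℕ n)))

fromℕ-* : ∀ m n → fromℕ (m * n) ≡ fromℕ m ℚ.* fromℕ n
fromℕ-* zero    n = sym (ℚ.*-zeroˡ (fromℕ n))
fromℕ-* (suc m) n = begin
  fromℕ (n + m * n)                       ≡⟨ fromℕ-+ n (m * n) ⟩
  fromℕ n ℚ.+ fromℕ (m * n)               ≡⟨ cong₂ ℚ._+_ (sym (ℚ.*-identityˡ (fromℕ n))) (fromℕ-* m n) ⟩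
  1ℚ ℚ.* fromℕ n ℚ.+ fromℕ m ℚ.* fromℕ n  ≡⟨ ℚ.*-distribʳ-+ (fromℕ n) 1ℚ (fromℕ m) ⟨
  (1ℚ ℚ.+ fromℕ m) ℚ.* fromℕ n            ∎
  where open ≡-Reasoning

fromℕ-nonNeg : ∀ n → 0ℚ ℚ.≤ fromℕ n
fromℕ-nonNeg zero    = ℚ.≤-refl
fromℕ-nonNeg (suc n) = ℚ.+-mono-≤ (ℚ.nonNegative⁻¹ 1ℚ) (fromℕ-nonNeg n)

fromℕ-mono : ∀ {m n} → m ≤ n → fromℕ m ℚ.≤ fromℕ n
fromℕ-mono {n = n} z≤n = fromℕ-nonNeg n
fromℕ-mono (s≤s h) = ℚ.+-monoʳ-≤ 1ℚ (fromℕ-mono h)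

toℚᵘ-fromℕ : ∀ n → toℚᵘ (fromℕ n) ℚᵘ.≃ mkℚᵘ (pos n) 0
toℚᵘ-fromℕ zero    = ℚᵘ.≃-refl
toℚᵘ-fromℕ (suc n) = begin
  toℚᵘ (1ℚ ℚ.+ fromℕ n)            ≈⟨ ℚ.toℚᵘ-homo-+ 1ℚ (fromℕ n) ⟩
  toℚᵘ 1ℚ ℚᵘ.+ toℚᵘ (fromℕ n)      ≈⟨ ℚᵘ.+-congʳ (toℚᵘ 1ℚ) (toℚᵘ-fromℕ n) ⟩
  toℚᵘ 1ℚ ℚᵘ.+ mkℚᵘ (pos n) 0        ≈⟨ *≡* (cong (λ i → (pos 1 ℤ.+ i) ℤ.* pos 1) (ℤ.*-identityʳ (pos n))) ⟩
  mkℚᵘ (pos (suc n)) 0                 ∎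
  where open ℚᵘ.≃-Reasoning

1/n*n : ∀ n .{{_ : NonZero n}} → pos 1 / n ℚ.* fromℕ n ≡ 1ℚ
1/n*n (suc n) = ℚ.toℚᵘ-injective (begin
  toℚᵘ (pos 1 / suc n ℚ.* fromℕ (suc n))            ≈⟨ ℚ.toℚᵘ-homo-* (pos 1 / suc n) (fromℕ (suc n)) ⟩
  toℚᵘ (pos 1 / suc n) ℚᵘ.* toℚᵘ (fromℕ (suc n))    ≈⟨ ℚᵘ.*-cong (ℚ.toℚᵘ-fromℚᵘ (mkℚᵘ (pos 1) n)) (toℚᵘ-fromℕ (suc n)) ⟩
  mkℚᵘ (pos 1) n ℚᵘ.* mkℚᵘ (pos (suc n)) 0              ≈⟨ *≡* (cong pos (identity n)) ⟩
  toℚᵘ 1ℚ                                         ∎)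
  where
  open ℚᵘ.≃-Reasoning
  identity : ∀ n → (1 * suc n) * 1 ≡ 1 * (suc n * 1)
  identity = solve-∀

reciprocal*n : ∀ n .{{_ : NonZero n}} → reciprocal n ℚ.* fromℕ n ≡ 1ℚ
reciprocal*n (suc n) = 1/n*n (suc n)

power : ℚ → ℕ → ℚ
power p zero    = 1ℚ
power p (suc T) = p ℚ.* power p T

power*^ : ∀ {p n} T → p ℚ.* fromℕ n ≡ 1ℚ → power p T ℚ.* fromℕ (n ^ T) ≡ 1ℚ
power*^ zero    h = refl
power*^ {p} {n} (suc T) h = begin
  p ℚ.* P ℚ.* fromℕ (n * n ^ T)              ≡⟨ cong (p ℚ.* P ℚ.*_) (fromℕ-* n (n ^ T)) ⟩
  p ℚ.* P ℚ.* (fromℕ n ℚ.* fromℕ (n ^ T))    ≡⟨ ℚ.*-assoc p P _ ⟩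
  p ℚ.* (P ℚ.* (fromℕ n ℚ.* fromℕ (n ^ T)))  ≡⟨ cong (p ℚ.*_) (ℚ.*-assoc P (fromℕ n) _) ⟨
  p ℚ.* (P ℚ.* fromℕ n ℚ.* fromℕ (n ^ T))    ≡⟨ cong (λ i → p ℚ.* (i ℚ.* fromℕ (n ^ T))) (ℚ.*-comm P (fromℕ n)) ⟩
  p ℚ.* (fromℕ n ℚ.* P ℚ.* fromℕ (n ^ T))    ≡⟨ cong (p ℚ.*_) (ℚ.*-assoc (fromℕ n) P _) ⟩
  p ℚ.* (fromℕ n ℚ.* (P ℚ.* fromℕ (n ^ T)))  ≡⟨ ℚ.*-assoc p (fromℕ n) _ ⟨
  p ℚ.* fromℕ n ℚ.* (P ℚ.* fromℕ (n ^ T))    ≡⟨ cong₂ ℚ._*_ h (power*^ T h) ⟩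
  1ℚ                                         ∎
  where
  open ≡-Reasoning
  P = power p T

module _ {n : ℕ} (Φ : CNF n) where

  μ^-value : ∀ {T} (X : Vec (Assignment n) T) →
    μ^ Φ X ≡ (if does (VecAll.all? (satisfies? Φ) X) then power (reciprocal (#solutions Φ)) T else 0ℚ)
  μ^-value [] = refl
  μ^-value {suc T} (x ∷ X) rewrite μ^-value X with does (satisfies? Φ x) | does (VecAll.all? (satisfies? Φ) X)
  ... | true  | true  = refl
  ... | true  | false = ℚ.*-zeroʳ (reciprocal (#solutions Φ))
  ... | false | true  = ℚ.*-zeroˡ (power (reciprocal (#solutions Φ)) T)
  ... | false | false = ℚ.*-zeroˡ 0ℚ

  -- All tuples of solutions carry the same mass and all other tuples none, so a probability is a
  -- count times a constant.
  mass-value : ∀ {T} {E : Pred (Vec (Assignment n) T) 0ℓ} (E? : Decidable E) Xs →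
    foldr ℚ._+_ 0ℚ (map (λ X → if does (E? X) then μ^ Φ X else 0ℚ) Xs) ≡
    fromℕ (# (VecAll.all? (satisfies? Φ) ∩? E?) Xs) ℚ.* power (reciprocal (#solutions Φ)) T
  mass-value {T} E? [] = sym (ℚ.*-zeroˡ (power (reciprocal (#solutions Φ)) T))
  mass-value {T} E? (X ∷ Xs) rewrite mass-value E? Xs | μ^-value X
    with does (VecAll.all? (satisfies? Φ) X) | does (E? X)
  ... | true  | true  = trans (cong (ℚ._+ fromℕ G ℚ.* p) (sym (ℚ.*-identityˡ p))) (sym (ℚ.*-distribʳ-+ p 1ℚ (fromℕ G)))
    where
    G = # (VecAll.all? (satisfies? Φ) ∩? E?) Xs
    p = power (reciprocal (#solutions Φ)) T
  ... | true  | false = ℚ.+-identityˡ _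
  ... | false | true  = ℚ.+-identityˡ _
  ... | false | false = ℚ.+-identityˡ _

  -- Bounds the complementary event by 1 / b. That the masses add up to 1 rests on Φ being
  -- satisfiable.
  Pr-≥ : ∀ {T b} {E : Pred (Vec (Assignment n) T) 0ℓ} (E? : Decidable E) .{{_ : NonZero (#solutions Φ)}} .{{_ : NonZero b}} →
         # (VecAll.all? (satisfies? Φ) ∩? ∁? E?) (tuples T (assignments n)) * b ≤ #solutions Φ ^ T →
         ∀ {r} → pos 1 / b ℚ.< r → 1ℚ ℚ.- r ℚ.≤ Pr Φ T E?
  Pr-≥ {T} {b} E? rare {r} h<r = begin
    1ℚ ℚ.- r                                  ≡⟨ cong (ℚ._- r) total ⟩
    (g ℚ.* p ℚ.+ f ℚ.* p) ℚ.- r               ≤⟨ ℚ.+-monoˡ-≤ (ℚ.- r) (ℚ.+-monoʳ-≤ (g ℚ.* p) (ℚ.≤-trans f≤ (ℚ.<⇒≤ h<r))) ⟩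
    (g ℚ.* p ℚ.+ r) ℚ.- r                     ≡⟨ ℚ.+-assoc (g ℚ.* p) r (ℚ.- r) ⟩
    g ℚ.* p ℚ.+ (r ℚ.- r)                     ≡⟨ cong (g ℚ.* p ℚ.+_) (ℚ.+-inverseʳ r) ⟩
    g ℚ.* p ℚ.+ 0ℚ                            ≡⟨ ℚ.+-identityʳ _ ⟩
    g ℚ.* p                                   ≡⟨ mass-value E? Xs ⟨
    Pr Φ T E?                                 ∎
    where
    open ℚ.≤-Reasoning
    Xs = tuples T (assignments n)
    N = #solutions Φ
    p = power (reciprocal N) T
    G = # (VecAll.all? (satisfies? Φ) ∩? E?) Xs
    F = # (VecAll.all? (satisfies? Φ) ∩? ∁? E?) Xs
    g = fromℕ G
    f = fromℕ F
    h = pos 1 / b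
    p*N^T : p ℚ.* fromℕ (N ^ T) ≡ 1ℚ
    p*N^T = power*^ T (reciprocal*n N)
    G+F : N ^ T ≡ G + F
    G+F = trans (sym (#-tuples (satisfies? Φ) T (assignments n))) (#-split (VecAll.all? (satisfies? Φ)) E? Xs)
    total : 1ℚ ≡ g ℚ.* p ℚ.+ f ℚ.* p
    total = begin-equality
      1ℚ                        ≡⟨ p*N^T ⟨
      p ℚ.* fromℕ (N ^ T)       ≡⟨ cong (λ i → p ℚ.* fromℕ i) G+F ⟩
      p ℚ.* fromℕ (G + F)       ≡⟨ cong (p ℚ.*_) (fromℕ-+ G F) ⟩
      p ℚ.* (g ℚ.+ f)           ≡⟨ ℚ.*-comm p _ ⟩
      (g ℚ.+ f) ℚ.* p           ≡⟨ ℚ.*-distribʳ-+ p g f ⟩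
      g ℚ.* p ℚ.+ f ℚ.* p       ∎
    power-nonNeg : ∀ T → ℚ.NonNegative (power (reciprocal N) T)
    power-nonNeg zero    = _
    power-nonNeg (suc T) = ℚ.nonNeg*nonNeg⇒nonNeg (reciprocal N) {{reciprocal-nonNeg N}} (power (reciprocal N) T) {{power-nonNeg T}}
      where
      reciprocal-nonNeg : ∀ N → ℚ.NonNegative (reciprocal N)
      reciprocal-nonNeg zero    = _
      reciprocal-nonNeg (suc N) = ℚ.normalize-nonNeg 1 (suc N)
    h-nonNeg : ∀ b .{{_ : NonZero b}} → ℚ.NonNegative (pos 1 / b)
    h-nonNeg b = ℚ.normalize-nonNeg 1 b
    f≤ : f ℚ.* p ℚ.≤ h
    f≤ = begin
      f ℚ.* p                             ≡⟨ ℚ.*-identityˡ _ ⟨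
      1ℚ ℚ.* (f ℚ.* p)                    ≡⟨ cong (ℚ._* (f ℚ.* p)) (1/n*n b) ⟨
      h ℚ.* fromℕ b ℚ.* (f ℚ.* p)         ≡⟨ ℚ.*-assoc h (fromℕ b) _ ⟩
      h ℚ.* (fromℕ b ℚ.* (f ℚ.* p))       ≡⟨ cong (h ℚ.*_) (ℚ.*-assoc (fromℕ b) f p) ⟨
      h ℚ.* (fromℕ b ℚ.* f ℚ.* p)         ≡⟨ cong (λ i → h ℚ.* (i ℚ.* p)) (ℚ.*-comm (fromℕ b) f) ⟩
      h ℚ.* (f ℚ.* fromℕ b ℚ.* p)         ≡⟨ cong (λ i → h ℚ.* (i ℚ.* p)) (fromℕ-* F b) ⟨
      h ℚ.* (fromℕ (F * b) ℚ.* p)         ≤⟨ ℚ.*-monoˡ-≤-nonNeg h {{h-nonNeg b}} (ℚ.*-monoʳ-≤-nonNeg p {{power-nonNeg T}} (fromℕ-mono rare)) ⟩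
      h ℚ.* (fromℕ (N ^ T) ℚ.* p)         ≡⟨ cong (h ℚ.*_) (trans (ℚ.*-comm (fromℕ (N ^ T)) p) p*N^T) ⟩
      h ℚ.* 1ℚ                            ≡⟨ ℚ.*-identityʳ h ⟩
      h                                   ∎

-- Running time

module _ {n : ℕ} where

  open ≤-Reasoning

  candidates-length : ∀ k (vs : List (Fin n)) → length (value (candidates k vs)) ≤ (2 * length vs) ^ k
  candidates-length zero    vs = ≤-refl
  candidates-length (suc k) [] = z≤n
  candidates-length (suc k) (v ∷ vs) = begin
    length (value (candidates (suc k) (v ∷ vs)))
      ≡⟨ cong length (candidates-value k v vs) ⟩
    length (map ((v , true) ∷_) cs ++ (map ((v , false) ∷_) cs ++ ds))
      ≡⟨ trans (length-++ (map ((v , true) ∷_) cs)) (cong₂ _+_ (length-map _ cs)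
           (trans (length-++ (map ((v , false) ∷_) cs)) (cong (_+ length ds) (length-map _ cs)))) ⟩
    length cs + (length cs + length ds)
      ≤⟨ +-mono-≤ (candidates-length k vs) (+-mono-≤ (candidates-length k vs) (candidates-length (suc k) vs)) ⟩
    P + (P + 2 * length vs * P)
      ≡⟨ rearrange P (length vs) ⟩
    2 * suc (length vs) * P
      ≤⟨ *-monoʳ-≤ (2 * suc (length vs)) (^-monoˡ-≤ k (*-monoʳ-≤ 2 (n≤1+n (length vs)))) ⟩
    2 * suc (length vs) * (2 * suc (length vs)) ^ k ∎
    where
    cs = value (candidates k vs)
    ds = value (candidates (suc k) vs)
    P = (2 * length vs) ^ k
    rearrange : ∀ P i → P + (P + 2 * i * P) ≡ 2 * suc i * P
    rearrange = solve-∀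

  prepend-steps : ∀ (l : Literal n) cs ds → steps (prepend l cs ds) ≡ suc (length cs)
  prepend-steps l []       ds = refl
  prepend-steps l (c ∷ cs) ds = cong suc (trans (+-identityʳ _) (prepend-steps l cs ds))

  -- A new variable adds the recursive call for `k`, two runs of `prepend` and three single steps:
  -- at most 3P + 3 ≤ 6P with P the bound for `k`, whence the 6. The successor keeps the base
  -- positive for the empty list.
  candidates-steps : ∀ k (vs : List (Fin n)) → steps (candidates k vs) ≤ (6 * suc (length vs)) ^ k
  candidates-steps zero    vs = ≤-refl
  candidates-steps (suc k) [] = m^n>0 6 (suc k)
  candidates-steps (suc k) (v ∷ vs) = begin
    steps (candidates (suc k) (v ∷ vs))
      ≡⟨ cong₂ (λ i j → suc (steps (candidates k vs) + (steps (candidates (suc k) vs) + (i + j))))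
           (prepend-steps (v , false) cs ds)
           (prepend-steps (v , true) cs (value (prepend (v , false) cs ds))) ⟩
    suc (steps (candidates k vs) + (steps (candidates (suc k) vs) + (suc (length cs) + suc (length cs))))
      ≤⟨ s≤s (+-mono-≤ (candidates-steps k vs) (+-mono-≤ (candidates-steps (suc k) vs) (+-mono-≤ (s≤s cs≤) (s≤s cs≤)))) ⟩
    suc (P + (6 * suc i * P + (suc P + suc P)))
      ≡⟨ rearrange₁ P i ⟩
    3 * 1 + (3 * P + 6 * suc i * P)
      ≤⟨ +-monoˡ-≤ _ (*-monoʳ-≤ 3 (m^n>0 (6 * suc i) k)) ⟩
    3 * P + (3 * P + 6 * suc i * P)
      ≡⟨ rearrange₂ P i ⟩
    6 * suc (suc i) * P
      ≤⟨ *-monoʳ-≤ (6 * suc (suc i)) (^-monoˡ-≤ k (*-monoʳ-≤ 6 (n≤1+n (suc i)))) ⟩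
    6 * suc (suc i) * (6 * suc (suc i)) ^ k ∎
    where
    i = length vs
    cs = value (candidates k vs)
    ds = value (candidates (suc k) vs)
    P = (6 * suc i) ^ k
    cs≤ : length cs ≤ P
    cs≤ = ≤-trans (candidates-length k vs) (^-monoˡ-≤ k (*-mono-≤ {2} {6} (s≤s (s≤s z≤n)) (n≤1+n i)))
    rearrange₁ : ∀ P i → suc (P + (6 * suc i * P + (suc P + suc P))) ≡ 3 * 1 + (3 * P + 6 * suc i * P)
    rearrange₁ = solve-∀
    rearrange₂ : ∀ P i → 3 * P + (3 * P + 6 * suc i * P) ≡ 6 * suc (suc i) * P
    rearrange₂ = solve-∀

  violates-steps : ∀ (x : Assignment n) c → steps (violates x c) ≤ suc (length c)
  violates-steps x []      = ≤-refl
  violates-steps x (l ∷ c) with does (holds? x l)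
  ... | true  = s≤s z≤n
  ... | false = s≤s (violates-steps x c)

  removeViolated-steps : ∀ {k} (x : Assignment n) cs → All (λ c → length c ≡ k) cs →
                         steps (removeViolated x cs) ≤ suc (length cs * (k + 2))
  removeViolated-steps x []       []       = ≤-refl
  removeViolated-steps {k} x (c ∷ cs) (h ∷ hs) = s≤s (begin
    steps (violates x c) + (steps (removeViolated x cs) + 0)
      ≤⟨ +-mono-≤ (≤-trans (violates-steps x c) (s≤s (≤-reflexive h))) (+-monoˡ-≤ 0 (removeViolated-steps x cs hs)) ⟩
    suc k + (suc (length cs * (k + 2)) + 0)
      ≡⟨ rearrange k (length cs * (k + 2)) ⟩
    k + 2 + length cs * (k + 2) ∎)
    where
    rearrange : ∀ k i → suc k + (suc i + 0) ≡ k + 2 + i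
    rearrange = solve-∀

  removeAll-steps : ∀ {k T M} (X : Vec (Assignment n) T) cs → All (λ c → length c ≡ k) cs → length cs ≤ M →
                    steps (removeAll X cs) ≤ suc (T * (2 + M * (k + 2)))
  removeAll-steps []      cs hs l = ≤-refl
  removeAll-steps {k} {suc T} {M} (x ∷ X) cs hs l = s≤s (begin
    steps (removeViolated x cs) + steps (removeAll X ds)
      ≤⟨ +-mono-≤ (≤-trans (removeViolated-steps x cs hs) (s≤s (*-monoˡ-≤ (k + 2) l))) (removeAll-steps X ds hs′ l′) ⟩
    suc (M * (k + 2)) + suc (T * (2 + M * (k + 2)))
      ≡⟨ rearrange (M * (k + 2)) (T * (2 + M * (k + 2))) ⟩
    2 + M * (k + 2) + T * (2 + M * (k + 2)) ∎)
    where
    ds = value (removeViolated x cs)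
    hs′ : All (λ c → length c ≡ k) ds
    hs′ = subst (All _) (sym (removeViolated-value x cs)) (All.filter⁺ (λ c → clause? c x) hs)
    l′ : length ds ≤ M
    l′ = ≤-trans (≤-reflexive (cong length (removeViolated-value x cs)))
           (≤-trans (length-filter (λ c → clause? c x) cs) l)
    rearrange : ∀ i j → suc i + suc j ≡ 2 + i + j
    rearrange = solve-∀

  allClauses-length : ∀ k → length (allClauses {n} k) ≤ (2 * n) ^ k
  allClauses-length k = subst (λ i → length (allClauses {n} k) ≤ (2 * i) ^ k)
    (length-tabulate {n = n} id) (candidates-length k (allFin n))

-- 12^k pays for generating the candidates, since 6(n + 1) ≤ 12n, and 2^k (k + 2) for testing them
-- against one sample; 5 covers listing the variables and the bookkeeping.
stepFactor : ℕ → ℕ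
stepFactor k = 5 + 12 ^ k + 2 ^ k * (k + 2)

valiant-steps : ∀ {n T} k (X : Vec (Assignment n) T) .{{_ : NonZero n}} .{{_ : NonZero k}} →
                steps (valiant k X) ≤ stepFactor k * n ^ k * suc T
valiant-steps {n} {T} k@(suc j) X = begin
  suc (suc n + (steps (candidates k (allFin n)) + steps (removeAll X (allClauses {n} k))))
    ≤⟨ s≤s (s≤s (+-mono-≤ n≤n^k (+-mono-≤ candidates≤ (removeAll-steps X (allClauses {n} k) widths (allClauses-length {n} k))))) ⟩
  suc (suc (p + (12 ^ k * p + suc (T * (2 + (2 * n) ^ k * (k + 2))))))
    ≡⟨ cong (λ i → suc (suc (p + (12 ^ k * p + suc (T * (2 + i * (k + 2))))))) (^-distribʳ-* k 2 n) ⟩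
  suc (suc (p + (12 ^ k * p + suc (T * (2 + 2 ^ k * p * (k + 2))))))
    ≡⟨ rearrange₁ p (12 ^ k) T (2 ^ k) (k + 2) ⟩
  (3 + 2 * T) * 1 + (p + 12 ^ k * p + T * (2 ^ k * p * (k + 2)))
    ≤⟨ +-monoˡ-≤ _ (*-monoʳ-≤ (3 + 2 * T) (m^n>0 n k)) ⟩
  (3 + 2 * T) * p + (p + 12 ^ k * p + T * (2 ^ k * p * (k + 2)))
    -- The surplus terms complete the sum to a multiple of `p * suc T`.
    ≤⟨ m≤m+n _ (p + 3 * T * p + T * (12 ^ k * p) + 2 ^ k * p * (k + 2)) ⟩
  (3 + 2 * T) * p + (p + 12 ^ k * p + T * (2 ^ k * p * (k + 2))) + (p + 3 * T * p + T * (12 ^ k * p) + 2 ^ k * p * (k + 2))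
    ≡⟨ rearrange₂ p (12 ^ k) T (2 ^ k) (k + 2) ⟩
  (5 + 12 ^ k + 2 ^ k * (k + 2)) * p * suc T ∎
  where
  open ≤-Reasoning
  p = n ^ k
  n≤n^k : n ≤ p
  n≤n^k = m≤m*n n (n ^ j) {{m^n≢0 n j}}
  widths : All (λ c → length c ≡ k) (allClauses {n} k)
  widths = All.tabulate (λ c∈ → proj₁ (proj₁ (candidates-sound k allFin-< c∈)))
  candidates≤ : steps (candidates k (allFin n)) ≤ 12 ^ k * p
  candidates≤ = begin
    steps (candidates k (allFin n))    ≤⟨ candidates-steps k (allFin n) ⟩
    (6 * suc (length (allFin n))) ^ k  ≡⟨ cong (λ i → (6 * suc i) ^ k) (length-tabulate {n = n} id) ⟩
    (6 * suc n) ^ k                    ≤⟨ ^-monoˡ-≤ k (*-monoʳ-≤ 6 (+-monoˡ-≤ n (>-nonZero⁻¹ n))) ⟩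
    (6 * (n + n)) ^ k                  ≡⟨ cong (_^ k) (double n) ⟩
    (12 * n) ^ k                       ≡⟨ ^-distribʳ-* k 12 n ⟩
    12 ^ k * p                         ∎
    where
    double : ∀ n → 6 * (n + n) ≡ 12 * n
    double = solve-∀
  rearrange₁ : ∀ p a T b c → suc (suc (p + (a * p + suc (T * (2 + b * p * c))))) ≡
               (3 + 2 * T) * 1 + (p + a * p + T * (b * p * c))
  rearrange₁ = solve-∀
  rearrange₂ : ∀ p a T b c →
    (3 + 2 * T) * p + (p + a * p + T * (b * p * c)) + (p + 3 * T * p + T * (a * p) + b * p * c) ≡
    (5 + a + b * c) * p * suc T
  rearrange₂ = solve-∀

-- Parameters

n<2^n : ∀ n → n < 2 ^ n
n<2^n zero    = s≤s z≤n
n<2^n (suc n) = begin-strict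
  1 + n           <⟨ +-mono-≤-< (m^n>0 2 n) (n<2^n n) ⟩
  2 ^ n + 2 ^ n   ≡⟨ cong (2 ^ n +_) (+-identityʳ (2 ^ n)) ⟨
  2 * 2 ^ n       ∎
  where open ≤-Reasoning

^-cancelˡ-≤ : ∀ {a m n} → 1 < a → a ^ m ≤ a ^ n → m ≤ n
^-cancelˡ-≤ {a} {m} {n} 1<a h with m ≤? n
... | yes m≤n = m≤n
... | no m≰n = ⊥-elim (<⇒≱ (^-monoʳ-< a 1<a (≰⇒> m≰n)) h)

^-cancelʳ-≤ : ∀ {m n} k .{{_ : NonZero k}} → m ^ k ≤ n ^ k → m ≤ n
^-cancelʳ-≤ {m} {n} k h with m ≤? n
... | yes m≤n = m≤n
... | no m≰n = ⊥-elim (<⇒≱ (^-monoˡ-< k (≰⇒> m≰n)) h)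

-- A slowly growing scale and the o(k) term

selfPower-mono : ∀ {m n} .{{_ : NonZero m}} → m ≤ n → m ^ m ≤ n ^ n
selfPower-mono {m@(suc _)} {n@(suc _)} m≤n = ≤-trans (^-monoˡ-≤ m m≤n) (^-monoʳ-≤ n m≤n)

-- The scale rises by at most one when `k` does. The decision is an argument so that `grow-lower`
-- and `grow-upper` can split on it.
grow : ∀ j k → Dec ((2 + j) ^ (2 + j) ≤ k) → ℕ
grow j k (yes _) = suc j
grow j k (no _)  = j

grow-lower : ∀ j k d → suc j ^ suc j ≤ k → suc (grow j k d) ^ suc (grow j k d) ≤ k
grow-lower j k (yes h) _ = h
grow-lower j k (no _)  h = h

grow-upper : ∀ j k d → k ≤ (2 + j) ^ (2 + j) → k < (2 + grow j k d) ^ (2 + grow j k d)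
grow-upper j k (yes _) h = ≤-<-trans h (<-≤-trans (^-monoˡ-< (2 + j) (n<1+n (2 + j))) (^-monoʳ-≤ (3 + j) (n≤1+n (2 + j))))
grow-upper j k (no ¬h) _ = ≰⇒> ¬h

-- Kept as the predecessor of the scale, so that the scale is visibly non-zero and can serve as a
-- divisor.
scale-1 : ℕ → ℕ
scale-1 zero    = 0
scale-1 (suc k) = grow (scale-1 k) (suc k) ((2 + scale-1 k) ^ (2 + scale-1 k) ≤? suc k)

-- scale k is, for k ≥ 1, the largest m with m ^ m ≤ k; it tends to infinity
-- but is eventually below every fixed root of k.
scale : ℕ → ℕ
scale k = suc (scale-1 k)

scale-lower : ∀ k → scale (suc k) ^ scale (suc k) ≤ suc k
scale-lower zero    = ≤-refl
scale-lower (suc k) = grow-lower (scale-1 (suc k)) (2 + k) (_ ≤? _) (≤-trans (scale-lower k) (n≤1+n (suc k)))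

scale-upper : ∀ k → k < suc (scale k) ^ suc (scale k)
scale-upper zero    = s≤s z≤n
scale-upper (suc k) = grow-upper (scale-1 k) (suc k) (_ ≤? _) (scale-upper k)

scale-large : ∀ {m k} → m ^ m ≤ k → m ≤ scale k
scale-large {m} {k} h with m ≤? scale k
... | yes m≤ = m≤
... | no m≰  = ⊥-elim (<-irrefl refl (<-≤-trans (scale-upper k) (≤-trans (selfPower-mono (≰⇒> m≰)) h)))

-- Of the four quotients, three pay for the variables a residual clause may lose and one for the
-- factor `k` in the local lemma.
slack : ℕ → ℕ
slack k = 4 * (k ℕ./ scale k)

slack-littleO : IsLittleO slack
-- From this threshold on the scale is at least `4 * m`.
slack-littleO m = (4 * m) ^ (4 * m) , bound
  where
  open ≤-Reasoning
  bound : ∀ k → (4 * m) ^ (4 * m) ≤ k → m * slack k ≤ k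
  bound k h = begin
    m * (4 * (k ℕ./ scale k))    ≡⟨ rearrange m (k ℕ./ scale k) ⟩
    (k ℕ./ scale k) * (4 * m)    ≤⟨ *-monoʳ-≤ (k ℕ./ scale k) (scale-large h) ⟩
    (k ℕ./ scale k) * scale k    ≤⟨ m/n*n≤m k (scale k) ⟩
    k                            ∎
    where
    rearrange : ∀ m q → m * (4 * q) ≡ q * (4 * m)
    rearrange = solve-∀

m*n≤o⇒n≤o/m : ∀ {m n o} .{{_ : NonZero m}} → m * n ≤ o → n ≤ o ℕ./ m
m*n≤o⇒n≤o/m {m} {n} {o} h = begin
  n              ≡⟨ m*n/n≡m n m ⟨
  n * m ℕ./ m    ≤⟨ /-monoˡ-≤ m (≤-trans (≤-reflexive (*-comm n m)) h) ⟩
  o ℕ./ m        ∎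
  where open ≤-Reasoning

-- The three thresholds on `C` have separate uses: the first makes the scale at least 2(p + 1),
-- which controls `s`; the second makes it at least 4, which makes `q` large against powers of the
-- scale; the third absorbs the factor 8 = 2^3 of the local lemma.
module Regime {k d s p : ℕ} .{{_ : NonZero d}} (C : ℕ) (s^≤ : s ^ suc p ≤ k ^ p)
              (C≥₁ : (2 * suc p) ^ (2 * suc p) ≤ C) (C≥₂ : 4 ^ 4 ≤ C) (C≥₃ : 3 ≤ C)
              (k≥ : k ≥log d + (slack k + C)) where

  open ≤-Reasoning

  m q : ℕ
  m = scale k
  q = k ℕ./ scale k

  -- As `d` is positive, the additive constant in the hypothesis already says that `k` is large.
  C≤k : C ≤ k
  C≤k = ^-cancelˡ-≤ (s≤s (s≤s z≤n)) (begin
    2 ^ C                   ≤⟨ ^-monoʳ-≤ 2 (m≤n+m C (slack k)) ⟩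
    2 ^ (slack k + C)       ≤⟨ m≤n*m _ d ⟩
    d * 2 ^ (slack k + C)   ≤⟨ k≥ ⟩
    2 ^ k                   ∎)

  k≥1 : 1 ≤ k
  k≥1 = ≤-trans (s≤s z≤n) (≤-trans C≥₃ C≤k)

  d≤2^k : d ≤ 2 ^ k
  d≤2^k = ≤-trans (m≤m*n d (2 ^ (slack k + C)) {{m^n≢0 2 (slack k + C)}}) k≥

  m^m≤k : m ^ m ≤ k
  m^m≤k = positive-case k≥1
    where
    positive-case : ∀ {k} → 1 ≤ k → scale k ^ scale k ≤ k
    positive-case {suc k} _ = scale-lower k

  m≥2Q : 2 * suc p ≤ m
  m≥2Q = scale-large (≤-trans C≥₁ C≤k)

  m≥4 : 4 ≤ m
  m≥4 = scale-large {4} (≤-trans C≥₂ C≤k)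

  m≤k : m ≤ k
  m≤k = ≤-trans (m≤m*n m (m ^ scale-1 k) {{m^n≢0 m (scale-1 k)}}) m^m≤k

  k<m+m*q : k < m + m * q
  k<m+m*q = begin-strict
    k                   ≡⟨ m≡m%n+[m/n]*n k m ⟩
    k ℕ.% m + q * m     <⟨ +-monoˡ-< (q * m) (m%n<n k m) ⟩
    m + q * m           ≡⟨ cong (m +_) (*-comm q m) ⟩
    m + m * q           ∎

  m*q≤k : m * q ≤ k
  m*q≤k = ≤-trans (≤-reflexive (*-comm m q)) (m/n*n≤m k m)

  3q≤k : 3 * q ≤ k
  3q≤k = ≤-trans (*-monoˡ-≤ q (≤-trans (n≤1+n 3) m≥4)) m*q≤k

  -- This is m² s ≤ k raised to the power p + 1: m^(2(p+1)) ≤ m^m ≤ k takes one factor `k` and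
  -- s^(p+1) ≤ k^p the others.
  m*s≤q : m * s ≤ q
  m*s≤q = m*n≤o⇒n≤o/m {m} {m * s} {k} (^-cancelʳ-≤ (suc p) (begin
    (m * (m * s)) ^ suc p             ≡⟨ cong (_^ suc p) (*-assoc m m s) ⟨
    (m * m * s) ^ suc p               ≡⟨ ^-distribʳ-* (suc p) (m * m) s ⟩
    (m * m) ^ suc p * s ^ suc p       ≡⟨ cong (λ i → i ^ suc p * s ^ suc p) (square m) ⟩
    (m ^ 2) ^ suc p * s ^ suc p       ≡⟨ cong (_* s ^ suc p) (^-*-assoc m 2 (suc p)) ⟩
    m ^ (2 * suc p) * s ^ suc p       ≤⟨ *-mono-≤ (≤-trans (^-monoʳ-≤ m m≥2Q) m^m≤k) s^≤ ⟩
    k * k ^ p                         ∎))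
    where
    square : ∀ m → m * m ≡ m * (m * 1)
    square = solve-∀

  m≤q : m ≤ q
  m≤q = m*n≤o⇒n≤o/m {m} {m} {k} (begin
    m * m      ≡⟨ cong (m *_) (*-identityʳ m) ⟨
    m ^ 2      ≤⟨ ^-monoʳ-≤ m (≤-trans (s≤s (s≤s z≤n)) m≥4) ⟩
    m ^ m      ≤⟨ m^m≤k ⟩
    k          ∎)

  -- By maximality of the scale, k < (m+1)^(m+1) ≤ 2^(m(m+1)), and m(m+1) ≤ q because m²(m+1) ≤ m^4
  -- ≤ m^m ≤ k for m ≥ 4.
  k≤2^q : k ≤ 2 ^ q
  k≤2^q = begin
    k                      ≤⟨ <⇒≤ (scale-upper k) ⟩
    suc m ^ suc m          ≤⟨ ^-monoˡ-≤ (suc m) (n<2^n m) ⟩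
    (2 ^ m) ^ suc m        ≡⟨ ^-*-assoc 2 m (suc m) ⟩
    2 ^ (m * suc m)        ≤⟨ ^-monoʳ-≤ 2 (m*n≤o⇒n≤o/m {m} {m * suc m} {k} cubic) ⟩
    2 ^ q                  ∎
    where
    cubic : m * (m * suc m) ≤ k
    cubic = begin
      m * (m * suc m)       ≤⟨ *-monoʳ-≤ m (*-monoʳ-≤ m (≤-trans (+-monoˡ-≤ m (≤-trans (s≤s z≤n) m≥4))
                                 (≤-trans (≤-reflexive (double m)) (*-monoˡ-≤ m (≤-trans (s≤s (s≤s z≤n)) m≥4))))) ⟩
      m * (m * (m * m))     ≡⟨ fourth m ⟩
      m ^ 4                 ≤⟨ ^-monoʳ-≤ m m≥4 ⟩
      m ^ m                 ≤⟨ m^m≤k ⟩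
      k                     ∎
      where
      double : ∀ m → m + m ≡ 2 * m
      double = solve-∀
      fourth : ∀ m → m * (m * (m * m)) ≡ m * (m * (m * (m * 1)))
      fourth = solve-∀

  -- The exponents add up to the hypothesis: `q` for `k`, 3 ≤ `C` for the constant 8, and `3 * q`
  -- for the lost width.
  8kd≤2^w : 4 * (k * (d + d)) ≤ 2 ^ (k ∸ 3 * q)
  8kd≤2^w = *-cancelʳ-≤ _ _ (2 ^ (3 * q)) {{m^n≢0 2 (3 * q)}} (begin
    4 * (k * (d + d)) * 2 ^ (3 * q)           ≤⟨ *-monoˡ-≤ (2 ^ (3 * q)) (*-monoʳ-≤ 4 (*-monoˡ-≤ (d + d) k≤2^q)) ⟩
    4 * (2 ^ q * (d + d)) * 2 ^ (3 * q)       ≡⟨ rearrange (2 ^ q) d (2 ^ (3 * q)) ⟩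
    d * (2 ^ q * 2 ^ (3 * q) * 8)             ≡⟨ cong (λ i → d * (i * 2 ^ 3)) (^-distribˡ-+-* 2 q (3 * q)) ⟨
    d * (2 ^ (4 * q) * 2 ^ 3)                 ≡⟨ cong (d *_) (^-distribˡ-+-* 2 (4 * q) 3) ⟨
    d * 2 ^ (4 * q + 3)                       ≤⟨ *-monoʳ-≤ d (^-monoʳ-≤ 2 (+-monoʳ-≤ (4 * q) C≥₃)) ⟩
    d * 2 ^ (4 * q + C)                       ≤⟨ k≥ ⟩
    2 ^ k                                     ≡⟨ cong (2 ^_) (m∸n+n≡m 3q≤k) ⟨
    2 ^ (k ∸ 3 * q + 3 * q)                   ≡⟨ ^-distribˡ-+-* 2 (k ∸ 3 * q) (3 * q) ⟩
    2 ^ (k ∸ 3 * q) * 2 ^ (3 * q)             ∎)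
    where
    rearrange : ∀ a d b → 4 * (a * (d + d)) * b ≡ d * (a * b * 8)
    rearrange = solve-∀

  4≤2^w : 4 ≤ 2 ^ (k ∸ 3 * q)
  4≤2^w = ≤-trans (*-monoʳ-≤ 4 {1} (*-mono-≤ k≥1 (≤-trans (>-nonZero⁻¹ d) (m≤m+n d d)))) 8kd≤2^w

-- Real parameters and logarithmic bounds

lower<upper : ∀ (x : ℝ) {p q} → lower x p → upper x q → p ℚ.< q
lower<upper x {p} {q} l u with ℚ.<-cmp p q
... | tri< p<q _ _  = p<q
... | tri≈ _ refl _ = ⊥-elim (disjoint x p (l , u))
... | tri> _ _ q<p  = ⊥-elim (disjoint x q (lower-closed x q<p l , u))

archimedean : ∀ q → 0ℚ ℚ.< q → ∃ λ p → pos 1 / (2 + p) ℚ.< q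
-- The numerator is at least 1, so 1/(b + 2) < 1/(b + 1) ≤ q; the 2 makes the inequality strict.
archimedean q@(mkℚ (pos (suc a)) b _) _ = b , subst (pos 1 / (2 + b) ℚ.<_) (ℚ.fromℚᵘ-toℚᵘ q)
  (/-mono-< {1} {2 + b} {suc a} {suc b} (*-mono-≤ {1} {suc a} {2 + b} (s≤s z≤n) (≤-refl {2 + b})))
archimedean q@(mkℚ (pos zero) _ _) 0<q with ℚ.positive 0<q
... | ()
archimedean q@(mkℚ -[1+ _ ] _ _) 0<q with ℚ.positive 0<q
... | ()

positive-lower : ∀ (x : ℝ) → lower x 0ℚ → ∃ λ p → lower x (pos 1 / (2 + p))
positive-lower x l with lower-open x l
... | q , 0<q , lq with archimedean q 0<q
...   | p , h = p , lower-closed x h lq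

1/2^_ : ℕ → ℚ
1/2^ i = (pos 1 / 2 ^ i) {{m^n≢0 2 i}}

-- A Dedekind cut cannot be compared with a single rational, only located between two. So the search
-- halves the upper bound and tests the next two powers against each other, which costs a factor 4
-- instead of 2. It ends because δ exceeds some 2^-(2+p).
dyadic-bracket : ∀ (δ : ℝ) → InUnitInterval δ → ∃ λ M → lower δ (1/2^ (2 + M)) × upper δ (1/2^ M)
dyadic-bracket δ (δ>0 , δ<1) with positive-lower δ δ>0
... | p , l = search (2 + p) 0 (+-identityʳ (2 + p)) δ<1
  where
  l′ : lower δ (1/2^ (2 + p))
  l′ = lower-closed δ (/-mono-< {1} {2 ^ (2 + p)} {1} {2 + p} {{m^n≢0 2 (2 + p)}}
         (*-monoʳ-< 1 (n<2^n (2 + p)))) l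
  search : ∀ j L → j + L ≡ 2 + p → upper δ (1/2^ L) → ∃ λ M → lower δ (1/2^ (2 + M)) × upper δ (1/2^ M)
  search zero    L refl u = ⊥-elim (disjoint δ _ (l′ , u))
  search (suc j) L eq u with located δ {1/2^ (2 + L)} {1/2^ (1 + L)}
    (/-mono-< {1} {2 ^ (2 + L)} {1} {2 ^ (1 + L)} {{m^n≢0 2 (2 + L)}} {{m^n≢0 2 (1 + L)}}
      (*-monoʳ-< 1 (^-monoʳ-< 2 (s≤s (s≤s z≤n)) (n<1+n (1 + L)))))
  ... | inj₁ low = L , low , u
  ... | inj₂ up  = search j (suc L) (trans (+-suc j L) eq) up

power-between : ∀ n .{{_ : NonZero n}} → ∃ λ l → n ≤ 2 ^ l × 2 ^ l ≤ 2 * n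
power-between (suc zero) = 0 , s≤s z≤n , s≤s z≤n
power-between (suc n@(suc _)) with power-between n
... | l , n≤ , ≤2n with suc n ≤? 2 ^ l
...   | yes h = l , h , ≤-trans ≤2n (*-monoʳ-≤ 2 (n≤1+n n))
...   | no ¬h = suc l , ≤-trans (s≤s n≤) (≤-trans (+-monoˡ-≤ (2 ^ l) (m^n>0 2 l)) (≤-reflexive (cong (2 ^ l +_) (sym (+-identityʳ (2 ^ l))))))
                , *-monoʳ-≤ 2 (<⇒≤ (≰⇒> ¬h))

power-between-square : ∀ {n} → 2 ≤ n → ∃ λ l → n ≤ 2 ^ l × 2 ^ l ≤ n * n
power-between-square {n@(suc _)} 2≤n with power-between n
... | l , n≤ , ≤2n = l , n≤ , ≤-trans ≤2n (*-monoˡ-≤ n 2≤n)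

log-mono : ∀ {m m′ C n} (δ : ℝ) → m′ ≤ m → m ≤ C ·log[ n / δ ] → m′ ≤ C ·log[ n / δ ]
log-mono {C = C} δ m′≤m h a b l = ≤-trans (*-monoʳ-≤ (a ^ C) (^-monoʳ-≤ 2 m′≤m)) (h a b l)

log-scale : ∀ {m C n} (δ : ℝ) j → m ≤ C ·log[ n / δ ] → (m * j) ≤ C * j ·log[ n / δ ]
log-scale {m} {C} {n} δ j h a b l = begin
  a ^ (C * j) * 2 ^ (m * j)      ≡⟨ cong₂ _*_ (^-*-assoc a C j) (^-*-assoc 2 m j) ⟨
  (a ^ C) ^ j * (2 ^ m) ^ j      ≡⟨ ^-distribʳ-* j (a ^ C) (2 ^ m) ⟨
  (a ^ C * 2 ^ m) ^ j            ≤⟨ ^-monoˡ-≤ j (h a b l) ⟩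
  ((b * n) ^ C) ^ j              ≡⟨ ^-*-assoc (b * n) C j ⟩
  (b * n) ^ (C * j)              ∎
  where open ≤-Reasoning

-- Powers of `n` pay for all rounding since n ≥ 2: 2^(l+1) ≤ n³ gives 3k and 4 ≤ n² gives 2. The
-- factor 2^M is enlarged to (2^M)^e to pair with a^e, and a / b < δ < 2^-M bounds their product by
-- b^e.
exponent-log : ∀ {n l M} (δ : ℝ) k → 2 ≤ n → 2 ^ l ≤ n * n → upper δ (1/2^ M) →
               (k * suc l + (2 + M)) ≤ 3 * k + 2 ·log[ n / δ ]
exponent-log {n} {l} {M} δ k 2≤n l≤ u a b {{b≢0}} low = begin
  a ^ e * 2 ^ (k * suc l + (2 + M))
    ≡⟨ cong (a ^ e *_) (trans (^-distribˡ-+-* 2 (k * suc l) (2 + M))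
         (cong₂ _*_ (trans (cong (2 ^_) (*-comm k (suc l))) (sym (^-*-assoc 2 (suc l) k))) (^-distribˡ-+-* 2 2 M))) ⟩
  a ^ e * ((2 * 2 ^ l) ^ k * (4 * 2 ^ M))
    ≤⟨ *-monoʳ-≤ (a ^ e) (*-mono-≤ (^-monoˡ-≤ k (*-mono-≤ 2≤n l≤)) (*-monoˡ-≤ (2 ^ M) (*-mono-≤ 2≤n 2≤n))) ⟩
  a ^ e * ((n * (n * n)) ^ k * (n * n * 2 ^ M))
    ≤⟨ *-monoʳ-≤ (a ^ e) (*-monoʳ-≤ ((n * (n * n)) ^ k) (*-monoʳ-≤ (n * n) M≤)) ⟩
  a ^ e * ((n * (n * n)) ^ k * (n * n * (2 ^ M) ^ e))
    ≡⟨ rearrange (a ^ e) ((n * (n * n)) ^ k) (n * n) ((2 ^ M) ^ e) ⟩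
  (a ^ e * (2 ^ M) ^ e) * ((n * (n * n)) ^ k * (n * n))
    ≡⟨ cong₂ _*_ (^-distribʳ-* e a (2 ^ M)) n^e ⟨
  (a * 2 ^ M) ^ e * n ^ e
    ≤⟨ *-monoˡ-≤ (n ^ e) (^-monoˡ-≤ e a2^M≤b) ⟩
  b ^ e * n ^ e
    ≡⟨ ^-distribʳ-* e b n ⟨
  (b * n) ^ e ∎
  where
  open ≤-Reasoning
  e = 3 * k + 2
  rearrange : ∀ a b c d → a * (b * (c * d)) ≡ (a * d) * (b * c)
  rearrange = solve-∀
  M≤ : 2 ^ M ≤ (2 ^ M) ^ e
  M≤ = begin
    2 ^ M          ≡⟨ *-identityʳ (2 ^ M) ⟨
    (2 ^ M) ^ 1    ≤⟨ ^-monoʳ-≤ (2 ^ M) {{m^n≢0 2 M}} (≤-trans (s≤s z≤n) (m≤n+m 2 (3 * k))) ⟩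
    (2 ^ M) ^ e    ∎
  a2^M≤b : a * 2 ^ M ≤ b
  a2^M≤b = <⇒≤ (<-≤-trans
    (/-cancel-< {a} {b} {1} {2 ^ M} {{b≢0}} {{m^n≢0 2 M}} (lower<upper δ low u))
    (≤-reflexive (*-identityˡ b)))
  cube : ∀ n → n * (n * n) ≡ n * (n * (n * 1))
  cube = solve-∀
  n^e : n ^ e ≡ (n * (n * n)) ^ k * (n * n)
  n^e = trans (^-distribˡ-+-* n (3 * k) 2)
    (cong₂ _*_ (trans (sym (^-*-assoc n 3 k)) (cong (_^ k) (sym (cube n)))) (cong (n *_) (*-identityʳ n)))

-- Assembling the theorem

satisfiable : ∀ {n k d w} (Φ : CNF n) → IsLocal k d w Φ → 4 * (k * d) ≤ 2 ^ w → 4 ≤ 2 ^ w → NonZero (#solutions Φ)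
satisfiable {n} {k} {d} {w} Φ loc 4kd≤ 4≤ = ≢-nonZero λ N≡0 → <⇒≱ nonempty (begin
  -- With Φ added to the empty formula, halving shows that a positive fraction of all assignments
  -- are solutions.
  #solutions {n} []                    ≤⟨ #solutions-halving 4≤ Φ [] (subst (IsLocal k d w) (sym (++-identityʳ Φ)) loc) ⟩
  2 ^ length Φ * #solutions (Φ ++ [])  ≡⟨ cong (λ Ψ → 2 ^ length Φ * #solutions Ψ) (++-identityʳ Φ) ⟩
  2 ^ length Φ * #solutions Φ          ≡⟨ cong (2 ^ length Φ *_) N≡0 ⟩
  2 ^ length Φ * 0                     ≡⟨ *-zeroʳ (2 ^ length Φ) ⟩
  0                                    ∎)
  where
  open ≤-Reasoning
  open LocalLemma {k = k} {d = d} {w = w} 4kd≤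
  nonempty : 0 < #solutions {n} []
  nonempty = <-≤-trans (∈-length (∈-assignments (replicate n true)))
    (≤-reflexive (sym (#-all (satisfies? []) (λ _ → []) (assignments n))))

-- At most 2k pinned variables, each in at most d ≤ 2 ^ k clauses; every
-- pinned variable and every clause touched costs a factor of 2.
likelihood : ℕ → ℕ
likelihood k = 2 ^ ((k + k) * 2 ^ k + (k + k))

-- One constant for both bounds: block length, multiple of log(n/δ) from `exponent-log`, and work
-- per sample doubled because T + 1 ≤ 2T.
rate : ℕ → ℕ
rate k = likelihood k * (3 * k + 2) * (2 * stepFactor k)

learning : ∀ {n k d s p} C .{{_ : NonZero d}} → s ^ suc p ≤ k ^ p →
  (2 * suc p) ^ (2 * suc p) ≤ C → 4 ^ 4 ≤ C → 3 ≤ C → k ≥log d + (slack k + C) →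
  2 ≤ n → (δ : ℝ) → InUnitInterval δ →
  ∃ λ T → T ≤ rate k ·log[ n / δ ] ×
  ((Φ : CNF n) → IsKDS-CNF k d s Φ →
     Pr Φ T (learns? k Φ) ≥1- δ ×
     ((X : Vec (Assignment n) T) → steps (valiant k X) ≤ rate k * n ^ k ·log[ n / δ ]))
learning {n} {k} {d} {s} {p} C s^≤ C≥₁ C≥₂ C≥₃ k≥ 2≤n δ δ∈
  with power-between-square 2≤n | dyadic-bracket δ δ∈
... | l , n≤2^l , 2^l≤n² | M , M-lower , M-upper = T , T-log , λ Φ kds → success Φ kds , cost
  where
  open ≤-Reasoning
  open Regime {k} {d} {s} {p} C s^≤ C≥₁ C≥₂ C≥₃ k≥
  y = likelihood k
  -- 2^a bounds the number (2n)^k of candidates through n ≤ 2^l, and 2^-b is below δ.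
  a = k * suc l
  b = 2 + M
  T = y * (a + b)
  instance
    y≢0 : NonZero y
    y≢0 = m^n≢0 2 ((k + k) * 2 ^ k + (k + k))
    k≢0 : NonZero k
    k≢0 = >-nonZero k≥1
    n≢0 : NonZero n
    n≢0 = >-nonZero (<⇒≤ 2≤n)
  T-log₀ : T ≤ y * (3 * k + 2) ·log[ n / δ ]
  T-log₀ = subst₂ (λ i j → i ≤ j ·log[ n / δ ]) (*-comm (a + b) y) (*-comm (3 * k + 2) y)
    (log-scale {a + b} {3 * k + 2} {n} δ y (exponent-log {n} {l} {M} δ k 2≤n 2^l≤n² M-upper))
  T-log : T ≤ rate k ·log[ n / δ ]
  T-log = log-mono {T * (2 * stepFactor k)} {T} {rate k} {n} δ (m≤m*n T (2 * stepFactor k))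
    (log-scale {T} {y * (3 * k + 2)} {n} δ (2 * stepFactor k) T-log₀)
  1≤T : 1 ≤ T
  1≤T = *-mono-≤ (>-nonZero⁻¹ y) (≤-trans (s≤s z≤n) (m≤n+m b a))
  cost : (X : Vec (Assignment n) T) → steps (valiant k X) ≤ rate k * n ^ k ·log[ n / δ ]
  cost X = subst (λ i → steps (valiant k X) ≤ i ·log[ n / δ ]) (sym (*-assoc (y * (3 * k + 2)) (2 * stepFactor k) (n ^ k)))
    (log-mono {T * (2 * stepFactor k * n ^ k)} {steps (valiant k X)} {y * (3 * k + 2) * (2 * stepFactor k * n ^ k)} {n} δ steps≤
      (log-scale {T} {y * (3 * k + 2)} {n} δ (2 * stepFactor k * n ^ k) T-log₀))
    where
    steps≤ : (steps (valiant k X)) ≤ T * (2 * stepFactor k * n ^ k)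
    steps≤ = begin
      steps (valiant k X)              ≤⟨ valiant-steps k X ⟩
      stepFactor k * n ^ k * suc T     ≤⟨ *-monoʳ-≤ (stepFactor k * n ^ k) (+-monoˡ-≤ T 1≤T) ⟩
      stepFactor k * n ^ k * (T + T)   ≡⟨ rearrange (stepFactor k) (n ^ k) T ⟩
      T * (2 * stepFactor k * n ^ k)   ∎
      where
      rearrange : ∀ A p T → A * p * (T + T) ≡ T * (2 * A * p)
      rearrange = solve-∀
  clauses≤ : length (allClauses {n} k) ≤ 2 ^ a
  clauses≤ = begin
    length (allClauses {n} k)   ≤⟨ allClauses-length k ⟩
    (2 * n) ^ k                 ≤⟨ ^-monoˡ-≤ k (*-monoʳ-≤ 2 n≤2^l) ⟩
    (2 ^ suc l) ^ k             ≡⟨ ^-*-assoc 2 (suc l) k ⟩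
    2 ^ (suc l * k)             ≡⟨ cong (2 ^_) (*-comm (suc l) k) ⟩
    2 ^ a                       ∎
  exponent≤ : (k + m) * d + (k + m) ≤ (k + k) * 2 ^ k + (k + k)
  exponent≤ = +-mono-≤ (*-mono-≤ (+-monoʳ-≤ k m≤k) d≤2^k) (+-monoʳ-≤ k m≤k)
  likely : ∀ {Φ : CNF n} {c τ} → IsKDS-CNF k d s Φ → IsKClause k c → Satisfies Φ τ → ¬ Any (Holds τ) c →
           #solutions Φ ≤ y * # (satisfies? Φ ∩? violated? c) (assignments n)
  likely {Φ} {c} {τ} kds kc sat ¬h = ≤-trans
    (violation-likely {m = m} {q = q} {c = c} {τ = τ} kds kc k<m+m*q m*s≤q m≤q 8kd≤2^w 4≤2^w sat ¬h)
    (*-monoˡ-≤ _ (^-monoʳ-≤ 2 exponent≤))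
  success : ∀ Φ → IsKDS-CNF k d s Φ → Pr Φ T (learns? k Φ) ≥1- δ
  success Φ kds {r} δ<r = Pr-≥ Φ {T = T} {b = 2 ^ b} (learns? k Φ)
    {{satisfiable Φ (kds-local kds (m∸n≤m k (3 * q)))
        (≤-trans (*-monoʳ-≤ 4 (*-monoʳ-≤ k (m≤m+n d d))) 8kd≤2^w) 4≤2^w}}
    {{m^n≢0 2 b}}
    (#-failures Φ {y} {a} {b} (IsKDS-CNF.width kds) clauses≤ (λ {c} {τ} → likely {Φ} {c} {τ} kds))
    (lower<upper δ M-lower δ<r)

theorem1p4 : ∃ λ (f : ℕ → ℕ) → IsLittleO f ×
    ((η : ℝ) → InUnitInterval η →
    ∃ λ (C : ℕ) → (k : ℕ) →
    ∃ λ (K : ℕ) → (d s : ℕ) → .{{_ : NonZero d}} →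
    s ≡ k ^[1- η ] →
    k ≥log d + (f k + C) →
    (n : ℕ) → 2 ≤ n → (δ : ℝ) → InUnitInterval δ →
    ∃ λ (T : ℕ) →
    T ≤ K ·log[ n / δ ] ×
    ((Φ : CNF n) → IsKDS-CNF k d s Φ →
    Pr Φ T (learns? k Φ) ≥1- δ ×
    ((X : Vec (Assignment n) T) →
    steps (valiant k X) ≤ K * n ^ k ·log[ n / δ ])))
theorem1p4 = slack , slack-littleO , λ η (η>0 , _) →
  let p , η>1/[2+p] = positive-lower η η>0
      a = (2 * (2 + p)) ^ (2 * (2 + p))
      -- The sum exceeds each of the three thresholds of `Regime`.
      C = a + (4 ^ 4 + 3)
  in C , λ k → rate k , λ d s s≡k^[1-η] k≥ n 2≤n δ δ∈ →
    learning {p = suc p} C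
      -- Only an upper bound on `s` enters, at the exponent (p + 1)/(p + 2), which lies above 1 - η
      -- because 1/(p + 2) < η.
      (proj₂ s≡k^[1-η] (suc p) (2 + p) (subst (lower η) (sym (1-p/[1+p] (suc p))) η>1/[2+p]))
      (m≤m+n a _) (≤-trans (m≤m+n (4 ^ 4) 3) (m≤n+m (4 ^ 4 + 3) a))
      (≤-trans (m≤n+m 3 (4 ^ 4)) (m≤n+m (4 ^ 4 + 3) a)) k≥ 2≤n δ δ∈
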